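{- Let $k \geq 2$ be an integer. Every $k$-connected graph $G$ of order $n \geq 6k+12-2\left\lceil \frac{k-2}{k} \right\rceil$ with $\delta(G) \geq \frac{n}{2}$ contains a Hamiltonian cycle $H$ such that $G-E(H)$ is $k$-connected.
   Context: All graphs are finite, simple and undirected. $\delta(G)$ denotes the minimum degree of $G$. For $F \subseteq E(G)$, $G-F$ is the graph obtained from $G$ by deleting the edges in $F$ (keeping all vertices). A graph is $k$-connected if its vertex connectivity $\kappa(G)$ is at least $k$. -}

module Defs where

open import Data.Nat using (ℕ; zero; suc; _+_; _*_; _∸_; _≤_; _<_; _<?_; NonZero)
open import Data.Nat.DivMod using (_/_)
open import Data.Bool using (Bool; true; false; _∧_; _∨_; not)
open import Data.Fin using (Fin; toℕ; fromℕ<) renaming (zero to fzero)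
open import Data.Fin.Properties using (_≟_)
open import Data.Fin.Subset using (Subset; _∈_; _∉_; ∣_∣)
open import Data.List using (List; allFin; map)
open import Data.Nat.ListAction using (sum)
open import Data.Bool.ListAction using (any)
open import Data.Product using (Σ; _×_)
open import Relation.Nullary using (yes; no)
open import Relation.Nullary.Decidable using (⌊_⌋)
open import Relation.Binary.PropositionalEquality using (_≡_)
open import Function.Definitions using (Injective)

record Graph (n : ℕ) : Set where
  field
    adj    : Fin n → Fin n → Bool
    sym    : ∀ u v → adj u v ≡ adj v u
    irrefl : ∀ u → adj u u ≡ false
open Graph public

degree : ∀ {n} → (Fin n → Fin n → Bool) → Fin n → ℕ
degree {n} a u = sum (map (λ v → if′ (a u v)) (allFin n))
  where
  if′ : Bool → ℕ
  if′ true  = 1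
  if′ false = 0

minDegreeAtLeastHalf : ∀ {n} → Graph n → Set
minDegreeAtLeastHalf {n} G = ∀ u → n ≤ 2 * degree (adj G) u

data Reach {n : ℕ} (a : Fin n → Fin n → Bool) (S : Subset n) : Fin n → Fin n → Set where
  here : ∀ {u} → u ∉ S → Reach a S u u
  step : ∀ {u w v} → u ∉ S → a u w ≡ true → Reach a S w v → Reach a S u v

KConnected : ∀ {n} → (Fin n → Fin n → Bool) → ℕ → Set
KConnected {n} a k =
  k < n × (∀ (S : Subset n) → ∣ S ∣ < k → ∀ u v → u ∉ S → v ∉ S → Reach a S u v)

next : ∀ {n} → Fin n → Fin n
next {suc m} i with suc (toℕ i) <? suc m
... | yes p = fromℕ< p
... | no _  = fzero

-- A Hamiltonian cycle of G: a cyclic ordering σ(0),σ(1),…,σ(n-1) of all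
-- vertices (σ injective, hence a bijection of Fin n), n ≥ 3, with
-- consecutive vertices (cyclically) adjacent in G.
record HamiltonianCycle {n : ℕ} (G : Graph n) : Set where
  field
    order     : Fin n → Fin n
    injective : Injective _≡_ _≡_ order
    atLeast3  : 3 ≤ n
    adjacent  : ∀ i → adj G (order i) (order (next i)) ≡ true
open HamiltonianCycle public

cycleEdge : ∀ {n} {G : Graph n} → HamiltonianCycle G → Fin n → Fin n → Bool
cycleEdge {n} H u v =
  any (λ i → (⌊ order H i ≟ u ⌋ ∧ ⌊ order H (next i) ≟ v ⌋)
           ∨ (⌊ order H i ≟ v ⌋ ∧ ⌊ order H (next i) ≟ u ⌋)) (allFin n)

minusCycle : ∀ {n} (G : Graph n) → HamiltonianCycle G → Fin n → Fin n → Bool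
minusCycle G H u v = adj G u v ∧ not (cycleEdge H u v)

-- ⌈ a / b ⌉ for b ≥ 1 (the value at b = 0 is irrelevant; set to 0)
ceilDiv : (a b : ℕ) → ℕ
ceilDiv a zero    = 0
ceilDiv a (suc b) = (a + b) / suc b

-- Let n ≥ 6k + 10 and let H be a Hamiltonian cycle of G (Dirac).  If G − E(H) is not k-connected,
-- some S with |S| < k separates it into A and B, and all edges of G between A and B lie on H.  Then
-- |A| and |B| are close to n/2 and A, B are nearly complete.  Assigning each vertex of S to the
-- side where it has more neighbours gives a partition V = X ∪ Y such that
--   * X minus fewer than k vertices lies in one component after deleting any Hamiltonian cycle,
--     and likewise for Y;
--   * any two vertices of X are the ends of a Hamiltonian path of G[X], and likewise for Y.
-- By König's theorem and the k-connectedness of G there is a matching of size k between X and Y,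
-- and by the degree condition there are two disjoint X-Y edges e, f outside it.  Two Hamiltonian
-- paths joined by e and f form a Hamiltonian cycle H* avoiding the matching, so that G − E(H*)
-- is k-connected.
--
-- Both Dirac's theorem and the Hamiltonian paths come from 2-exchanges: a path visiting the
-- required vertices is improved by reversing segments, lowering the total cost of its steps.

module Submission where

open import Defs hiding (sym)
open import Data.Nat using (ℕ; zero; suc; _+_; _*_; _∸_; _≤_; _<_; z≤n; s≤s; _<?_; _≤ᵇ_)
open import Data.Nat.Properties hiding (_≟_)
open import Data.Nat.DivMod using (m<n*o⇒m/o<n)
open import Data.Nat.ListAction using (sum)
open import Data.Nat.ListAction.Properties using (sum-↭)
open import Data.Nat.Tactic.RingSolver using (solve-∀)
open import Data.Bool.Properties using (T?; T-≡; ∨-comm) renaming (_≟_ to _≟ᵇ_)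
open import Data.Bool using (Bool; true; false; _∧_; _∨_; not; T)
open import Data.Bool.ListAction using (any; or)
open import Data.Fin using (Fin; toℕ; cast)
open import Data.Fin.Properties using (any?; _≟_; toℕ-injective; toℕ-cast; toℕ-fromℕ<; toℕ<n)
open import Data.List using (List; []; _∷_; _++_; map; length; lookup; filter; filterᵇ; cartesianProduct; allFin)
open import Data.List.Properties using (∷-injective; ++-assoc; length-++; map-++; length-filter; map-cong; length-map; map-tabulate; length-tabulate)
open import Data.List.Membership.Propositional using () renaming (_∈_ to _∈ₗ_; _∉_ to _∉ₗ_)
open import Data.List.Membership.Propositional.Properties using (∈-++⁻; ∈-++⁺ˡ; ∈-++⁺ʳ; ∈-map⁺; ∈-map⁻; ∈-filter⁺; ∈-filter⁻; ∈-allFin; ∈-∃++; ∈-cartesianProduct⁺)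
open import Data.List.Relation.Unary.Any using (here; there)
import Data.List.Relation.Unary.All as All
open import Data.List.Relation.Unary.All using () renaming (_∷_ to _∷ᵃ_)
open import Data.List.Relation.Unary.AllPairs using () renaming ([] to []ᵖ; _∷_ to _∷ᵖ_)
open import Data.List.Relation.Unary.Unique.Propositional using (Unique)
import Data.List.Relation.Unary.Unique.Propositional.Properties as Unique
open import Data.List.Relation.Binary.Disjoint.Propositional using (Disjoint)
open import Data.List.Relation.Binary.Permutation.Propositional using (_↭_; ↭-refl; ↭-sym; ↭-trans; prep; ↭-reflexive)
import Data.List.Relation.Binary.Permutation.Propositional.Properties as Perm
open import Data.Fin.Subset using (Subset; _∉_; ∣_∣)
open import Data.Fin.Subset.Properties using (anySubset?; _∈?_)
import Data.Vec as Vec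
open import Data.Vec.Properties using (lookup∘tabulate; lookup⇒[]=; []=⇒lookup)
open import Data.Product using (Σ; ∃-syntax; _×_; _,_; proj₁; proj₂)
open import Data.Sum using (_⊎_; inj₁; inj₂; [_,_]′)
open import Data.Empty using (⊥; ⊥-elim)
open import Data.Unit using (⊤; tt)
open import Relation.Nullary using (¬_; Dec; yes; no)
open import Relation.Nullary.Decidable using (⌊_⌋; _×-dec_; ¬?)
open import Relation.Binary.PropositionalEquality using (_≡_; _≢_; refl; sym; trans; cong; cong₂; subst; subst₂; module ≡-Reasoning)
open import Function using (_∘_; id)
open import Function.Bundles using (Equivalence)

-- The constant 10. Outside its core, a core vertex has fewer than `k` neighbours in S and at most
-- two, along H, in the other core; so it has at least n/2 - k - 1 neighbours in its own core. As
-- this holds on both sides, no core exceeds n/2 + 1 vertices. After the deletion of any Hamiltonian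
-- cycle, two core vertices keep together at least n - 2k - 6 neighbours in their core; if they are
-- nonadjacent, at least n/2 - 2k - 5 of these are common. For n ≥ 6k + 10 this is at least `k`, so
-- fewer than `k` further deletions cannot separate them. The obstacle is S: a vertex of S is only
-- guaranteed about n/4 neighbours in the core that it joins, so the usual degree-sum argument for
-- Hamiltonian paths fails in X and Y. The exchanges there minimise a weighted cost that forbids
-- consecutive vertices outside the core, since core vertices are the ones with many neighbours.
-- Exchanges fix both ends of a path, so a cycle is treated as a path whose start is repeated at its
-- end.

-- Counting

-- Linear arithmetic: the hypotheses are summed up to L ≤ R, and c is the slack left in the conclusion.
linear : ∀ {a b L R} c → L ≤ R → a + R + c ≡ b + L → a ≤ b
linear {a} {b} {L} {R} c h e = +-cancelʳ-≤ L a b (begin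
  a + L      ≤⟨ +-monoʳ-≤ a h ⟩
  a + R      ≤⟨ m≤m+n (a + R) c ⟩
  a + R + c  ≡⟨ e ⟩
  b + L      ∎)
  where open ≤-Reasoning

bit : Bool → ℕ
bit true  = 1
bit false = 0

bit≤1 : ∀ b → bit b ≤ 1
bit≤1 true  = ≤-refl
bit≤1 false = z≤n

module _ {A : Set} where

  ∑ : (A → ℕ) → List A → ℕ
  ∑ f xs = sum (map f xs)

  count : (A → Bool) → List A → ℕ
  count p = ∑ (bit ∘ p)

  ∑-mono : ∀ {f g : A → ℕ} → (∀ x → f x ≤ g x) → ∀ xs → ∑ f xs ≤ ∑ g xs
  ∑-mono h []       = z≤n
  ∑-mono h (x ∷ xs) = +-mono-≤ (h x) (∑-mono h xs)

  ∑-cong : ∀ {f g : A → ℕ} → (∀ x → f x ≡ g x) → ∀ xs → ∑ f xs ≡ ∑ g xs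
  ∑-cong h []       = refl
  ∑-cong h (x ∷ xs) = cong₂ _+_ (h x) (∑-cong h xs)

  ∑-+ : ∀ (f g : A → ℕ) xs → ∑ (λ x → f x + g x) xs ≡ ∑ f xs + ∑ g xs
  ∑-+ f g []       = refl
  ∑-+ f g (x ∷ xs) = trans (cong (f x + g x +_) (∑-+ f g xs)) (interchange (f x) (g x) _ _)
    where
    interchange : ∀ a b c d → a + b + (c + d) ≡ a + c + (b + d)
    interchange = solve-∀

  ∑-one : ∀ xs → ∑ (λ (_ : A) → 1) xs ≡ length xs
  ∑-one []       = refl
  ∑-one (x ∷ xs) = cong suc (∑-one xs)

  ∑-zero : ∀ xs → ∑ (λ (_ : A) → 0) xs ≡ 0
  ∑-zero []       = refl
  ∑-zero (x ∷ xs) = ∑-zero xs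

  ∑-++ : ∀ (f : A → ℕ) xs ys → ∑ f (xs ++ ys) ≡ ∑ f xs + ∑ f ys
  ∑-++ f []       ys = refl
  ∑-++ f (x ∷ xs) ys = trans (cong (f x +_) (∑-++ f xs ys)) (sym (+-assoc (f x) _ _))

  ∑-↭ : ∀ (f : A → ℕ) {xs ys} → xs ↭ ys → ∑ f xs ≡ ∑ f ys
  ∑-↭ f p = sum-↭ (Perm.map⁺ f p)

∑s : ∀ {A : Set} → List (A → ℕ) → List A → ℕ
∑s fs xs = ∑ (λ f → ∑ f xs) fs

∑-swap : ∀ {A B : Set} (f : A → B → ℕ) xs ys →
         ∑ (λ x → ∑ (f x) ys) xs ≡ ∑ (λ y → ∑ (λ x → f x y) xs) ys
∑-swap f []       ys = sym (∑-zero ys)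
∑-swap f (x ∷ xs) ys = trans (cong (∑ (f x) ys +_) (∑-swap f xs ys))
                             (sym (∑-+ (f x) (λ y → ∑ (λ x → f x y) xs) ys))

-- The common form of the counting arguments: an inequality between indicators, checked pointwise by
-- cases on Booleans, is summed over all vertices.
∑-compare : ∀ {A : Set} (fs gs : List (A → ℕ)) →
            (∀ x → ∑ (λ f → f x) fs ≤ ∑ (λ g → g x) gs) → ∀ xs → ∑s fs xs ≤ ∑s gs xs
∑-compare fs gs h xs = begin
  ∑ (λ f → ∑ f xs) fs          ≡⟨ ∑-swap id fs xs ⟩
  ∑ (λ x → ∑ (λ f → f x) fs) xs  ≤⟨ ∑-mono h xs ⟩
  ∑ (λ x → ∑ (λ g → g x) gs) xs  ≡⟨ sym (∑-swap id gs xs) ⟩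
  ∑ (λ g → ∑ g xs) gs          ∎
  where open ≤-Reasoning

-- Paths as a first vertex with the list of later vertices

module _ {V : Set} where

  end : V → List V → V
  end u []       = u
  end u (y ∷ ys) = end y ys

  end-++ : ∀ u xs ys → end u (xs ++ ys) ≡ end (end u xs) ys
  end-++ u []       ys = refl
  end-++ u (x ∷ xs) ys = end-++ x xs ys

  cost : (V → V → ℕ) → V → List V → ℕ
  cost w u []       = 0
  cost w u (y ∷ ys) = w u y + cost w y ys

  cost-++ : ∀ w u xs ys → cost w u (xs ++ ys) ≡ cost w u xs + cost w (end u xs) ys
  cost-++ w u []       ys = refl
  cost-++ w u (x ∷ xs) ys = trans (cong (w u x +_) (cost-++ w x xs ys)) (sym (+-assoc (w u x) _ _))

  -- A position at which `u` is directly followed by `u′`. The position is kept, not just the pair,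
  -- since the list has to be cut there.
  record Slot (x : V) (xs : List V) (u u′ : V) : Set where
    constructor slot
    field
      before after : List V
      split        : xs ≡ before ++ u′ ∷ after
      ends         : end x before ≡ u

  positive-slot : ∀ w x xs → 0 < cost w x xs → ∃[ u ] ∃[ u′ ] (Slot x xs u u′ × 0 < w u u′)
  positive-slot w x (y ∷ ys) c with w x y in eq
  ... | suc _ = x , y , slot [] ys refl refl , subst (0 <_) (sym eq) (s≤s z≤n)
  ... | zero  with positive-slot w y ys c
  ...   | u , u′ , slot b a s e , c′ = u , u′ , slot (y ∷ b) a (cong (y ∷_) s) e , c′

  slot-cost : ∀ w {x xs u u′} → Slot x xs u u′ → w u u′ ≤ cost w x xs
  slot-cost w {x} {_} {_} {u′} (slot b a refl refl) = begin
    w (end x b) u′                                       ≤⟨ m≤m+n _ _ ⟩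
    cost w (end x b) (u′ ∷ a)                            ≤⟨ m≤n+m _ (cost w x b) ⟩
    cost w x b + cost w (end x b) (u′ ∷ a)               ≡⟨ sym (cost-++ w x b (u′ ∷ a)) ⟩
    cost w x (b ++ u′ ∷ a)                               ∎
    where open ≤-Reasoning

  both neither : (V → Bool) → (V → Bool) → V → V → ℕ
  both    g h v v′ = bit (g v ∧ h v′)
  neither g h v v′ = bit (not (g v) ∧ not (h v′))

  -- Every step `v v′` satisfies [g v] + [h v′] + [neither] = [both] + 1; this is summed over the
  -- path. The tails of the steps are all vertices but the last, hence the correction
  -- `g (end x xs)`; the heads are the entries of `xs`.
  slot-count : ∀ g h x xs →
    count g (x ∷ xs) + count h xs + cost (neither g h) x xs
      ≡ cost (both g h) x xs + (length xs + bit (g (end x xs)))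
  slot-count g h x []       = refl+0 (bit (g x))
    where
    refl+0 : ∀ a → a + 0 + 0 + 0 ≡ a
    refl+0 = solve-∀
  slot-count g h x (y ∷ ys) =
    combine (bit (g x)) (count g (y ∷ ys)) (bit (h y)) (count h ys)
            (neither g h x y) (cost (neither g h) y ys) (both g h x y) (cost (both g h) y ys)
            (length ys + bit (g (end y ys))) (pointwise (g x) (h y)) (slot-count g h y ys)
    where
    pointwise : ∀ a b → bit a + bit b + bit (not a ∧ not b) ≡ bit (a ∧ b) + 1
    pointwise true  true  = refl
    pointwise true  false = refl
    pointwise false true  = refl
    pointwise false false = refl
    regroup₁ : ∀ a b c d e f → a + b + (c + d) + (e + f) ≡ a + c + e + (b + d + f)
    regroup₁ = solve-∀
    regroup₂ : ∀ a b c → a + 1 + (b + c) ≡ a + b + (1 + c)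
    regroup₂ = solve-∀
    combine : ∀ a b c d e f p q r → a + c + e ≡ p + 1 → b + d + f ≡ q + r →
              a + b + (c + d) + (e + f) ≡ p + q + (1 + r)
    combine a b c d e f p q r h₁ h₂ =
      trans (regroup₁ a b c d e f) (trans (cong₂ _+_ h₁ h₂) (regroup₂ p q r))

  find-slot : ∀ g h x xs →
    length xs + bit (g (end x xs)) < count g (x ∷ xs) + count h xs + cost (neither g h) x xs →
    ∃[ v ] ∃[ v′ ] (Slot x xs v v′ × g v ≡ true × h v′ ≡ true)
  find-slot g h x xs lt with positive-slot (both g h) x xs
    (linear 0 lt (trans (+-identityʳ _) (trans (cong suc (slot-count g h x xs)) (sym (+-suc _ _)))))
  ... | v , v′ , s , c = v , v′ , s , positive-∧ (g v) (h v′) c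
    where
    positive-∧ : ∀ a b → 0 < bit (a ∧ b) → a ≡ true × b ≡ true
    positive-∧ true true _ = refl , refl

  compare-splits : ∀ (P Q : List V) {a b R T} → P ++ a ∷ R ≡ Q ++ b ∷ T →
    (P ≡ Q × a ≡ b) ⊎ (∃[ m ] Q ≡ P ++ a ∷ m) ⊎ (∃[ m ] P ≡ Q ++ b ∷ m)
  compare-splits []      []       refl = inj₁ (refl , refl)
  compare-splits []      (y ∷ Q)  refl = inj₂ (inj₁ (Q , refl))
  compare-splits (x ∷ P) []       refl = inj₂ (inj₂ (P , refl))
  compare-splits (x ∷ P) (y ∷ Q)  eq with ∷-injective eq
  ... | refl , eq′ with compare-splits P Q eq′
  ...   | inj₁ (refl , e)        = inj₁ (refl , e)
  ...   | inj₂ (inj₁ (m , refl)) = inj₂ (inj₁ (m , refl))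
  ...   | inj₂ (inj₂ (m , refl)) = inj₂ (inj₂ (m , refl))

-- 2-exchanges on paths with fixed ends

module Exchange {V : Set} (w : V → V → ℕ) (w-sym : ∀ u v → w u v ≡ w v u)
                (w-diag : ∀ u v → w u v ≤ w u u + w v v) where

  -- The start stays outside the list and the last vertex is preserved, so a closed path remains
  -- closed.
  Rearrangement : V → List V → List V → Set
  Rearrangement x xs ys = ys ↭ xs × end x ys ≡ end x xs

  backwards : ∀ u ys → ∃[ zs ] (end u ys ∷ zs ↭ u ∷ ys × end (end u ys) zs ≡ u
                                × cost w (end u ys) zs ≡ cost w u ys)
  backwards u []       = [] , ↭-refl , refl , refl
  backwards u (y ∷ ys) with backwards y ys
  ... | zs , p , e , c =
    zs ++ u ∷ []
    , ↭-trans (Perm.++-comm (end y ys ∷ zs) (u ∷ [])) (prep u p)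
    , end-++ _ zs (u ∷ [])
    , (begin
        cost w z (zs ++ u ∷ [])              ≡⟨ cost-++ w z zs (u ∷ []) ⟩
        cost w z zs + (w (end z zs) u + 0)   ≡⟨ cong₂ _+_ c (trans (+-identityʳ _) (trans (cong (λ t → w t u) e) (w-sym y u))) ⟩
        cost w y ys + w u y                  ≡⟨ +-comm _ (w u y) ⟩
        w u y + cost w y ys                  ∎)
    where
    open ≡-Reasoning
    z = end y ys

  -- Reversing the segment between the two slots replaces u u′ and v v′ by u v and u′ v′.
  reverse-segment : ∀ x P u′ m v′ T → let u = end x P ; v = end u′ m ; xs = (P ++ u′ ∷ m) ++ v′ ∷ T in
    ∃[ ys ] (Rearrangement x xs ys
             × cost w x ys + (w u u′ + w v v′) ≡ cost w x xs + (w u v + w u′ v′))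
  reverse-segment x P u′ m v′ T with backwards u′ m
  ... | zs , p , e , c = ys , (↭ys , trans (end-last P (v ∷ zs)) (sym (end-last P (u′ ∷ m)))) , (begin
      cost w x ys + (w u u′ + w v v′)
        ≡⟨ cong (_+ (w u u′ + w v v′)) (expand v zs) ⟩
      cost w x P + (w u v + (cost w v zs + (w (end v zs) v′ + cost w v′ T))) + (w u u′ + w v v′)
        ≡⟨ cong₂ (λ s t → cost w x P + (w u v + (s + (w t v′ + cost w v′ T))) + (w u u′ + w v v′)) c e ⟩
      cost w x P + (w u v + (cost w u′ m + (w u′ v′ + cost w v′ T))) + (w u u′ + w v v′)
        ≡⟨ regroup (cost w x P) (w u v) (cost w u′ m) (w u′ v′) (cost w v′ T) (w u u′) (w v v′) ⟩
      cost w x P + (w u u′ + (cost w u′ m + (w v v′ + cost w v′ T))) + (w u v + w u′ v′)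
        ≡⟨ cong (_+ (w u v + w u′ v′)) (sym (expand u′ m)) ⟩
      cost w x ((P ++ u′ ∷ m) ++ v′ ∷ T) + (w u v + w u′ v′) ∎)
    where
    open ≡-Reasoning
    u = end x P
    v = end u′ m
    ys = (P ++ v ∷ zs) ++ v′ ∷ T
    ↭ys : ys ↭ (P ++ u′ ∷ m) ++ v′ ∷ T
    ↭ys = Perm.++⁺ʳ (v′ ∷ T) (Perm.++⁺ˡ P p)
    end-last : ∀ Q r → end x ((Q ++ r) ++ v′ ∷ T) ≡ end v′ T
    end-last Q r = end-++ x (Q ++ r) (v′ ∷ T)
    expand : ∀ a r → cost w x ((P ++ a ∷ r) ++ v′ ∷ T)
                     ≡ cost w x P + (w u a + (cost w a r + (w (end a r) v′ + cost w v′ T)))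
    expand a r = begin
      cost w x ((P ++ a ∷ r) ++ v′ ∷ T)
        ≡⟨ cong (cost w x) (++-assoc P (a ∷ r) (v′ ∷ T)) ⟩
      cost w x (P ++ a ∷ r ++ v′ ∷ T)
        ≡⟨ cost-++ w x P (a ∷ r ++ v′ ∷ T) ⟩
      cost w x P + (w u a + cost w a (r ++ v′ ∷ T))
        ≡⟨ cong (λ t → cost w x P + (w u a + t)) (cost-++ w a r (v′ ∷ T)) ⟩
      cost w x P + (w u a + (cost w a r + (w (end a r) v′ + cost w v′ T))) ∎
    regroup : ∀ a b c d e f g → a + (b + (c + (d + e))) + (f + g) ≡ a + (f + (c + (g + e))) + (b + d)
    regroup = solve-∀

  exchange-ordered : ∀ x P u′ m v′ T →
    let u = end x P ; v = end u′ m ; xs = (P ++ u′ ∷ m) ++ v′ ∷ T in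
    w u v + w u′ v′ < w u u′ + w v v′ → ∃[ ys ] (Rearrangement x xs ys × cost w x ys < cost w x xs)
  exchange-ordered x P u′ m v′ T lt with reverse-segment x P u′ m v′ T
  ... | ys , r , c = ys , r , linear 0 (+-mono-≤ lt (≤-reflexive c)) (arith (cost w x ys) _ (w u u′ + w v v′) (w u v + w u′ v′))
    where
    u = end x P
    v = end u′ m
    arith : ∀ a b s t → suc a + (s + (b + t)) + 0 ≡ b + (suc t + (a + s))
    arith = solve-∀

  -- Whichever slot comes first, the segment between them is reversed; the cost of the removed step
  -- `v v′` is a further gain. If the slots coincide there is nothing to reverse, but then the
  -- hypothesis contradicts `w-diag`.
  exchange : ∀ {x xs u u′ v v′} → Slot x xs u u′ → Slot x xs v v′ → w u v + w u′ v′ < w u u′ →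
             ∃[ ys ] (Rearrangement x xs ys × cost w x ys < cost w x xs)
  exchange {x} {_} {u} {u′} {v} {v′} (slot P R refl refl) (slot Q T eq refl) lt
    with compare-splits P Q eq
  ... | inj₁ (refl , refl) = ⊥-elim (<⇒≱ lt (w-diag u u′))
  ... | inj₂ (inj₁ (m , refl)) rewrite eq | end-++ x P (u′ ∷ m) =
    exchange-ordered x P u′ m v′ T (m≤n⇒m≤n+o _ lt)
  ... | inj₂ (inj₂ (m , refl)) rewrite end-++ x Q (v′ ∷ m) =
    exchange-ordered x Q v′ m u′ R
      (m≤n⇒m≤o+n _ (subst (_< w (end v′ m) u′) (cong₂ _+_ (w-sym _ v) (w-sym u′ v′)) lt))

  minimise : ∀ x xs →
    (∀ ys → Rearrangement x xs ys → 0 < cost w x ys →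
       ∃[ zs ] (Rearrangement x ys zs × cost w x zs < cost w x ys)) →
    ∃[ ys ] (Rearrangement x xs ys × cost w x ys ≡ 0)
  minimise x xs improve = go (cost w x xs) xs (↭-refl , refl) ≤-refl
    where
    go : ∀ m ys → Rearrangement x xs ys → cost w x ys ≤ m →
         ∃[ zs ] (Rearrangement x xs zs × cost w x zs ≡ 0)
    go zero    ys r       le = ys , r , n≤0⇒n≡0 le
    go (suc m) ys (p , e) le with cost w x ys in eq
    ... | zero  = ys , (p , e) , eq
    ... | suc c with improve ys (p , e) (subst (0 <_) (sym eq) (s≤s z≤n))
    ...   | zs , (p′ , e′) , lt = go m zs (↭-trans p′ p , trans e′ e)
                                    (≤-pred (≤-trans (subst (cost w x zs <_) eq lt) le))

-- Sets of vertices as Boolean predicates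

∧-true : ∀ {a b} → a ∧ b ≡ true → a ≡ true × b ≡ true
∧-true {true} {true} _ = refl , refl

true-∧ : ∀ {a b} → a ≡ true → b ≡ true → a ∧ b ≡ true
true-∧ refl refl = refl

not-true : ∀ {a} → not a ≡ true → a ≡ false
not-true {false} _ = refl

true≢false : ∀ {a} {W : Set} → a ≡ true → a ≡ false → W
true≢false refl ()

bit-true : ∀ {a} → a ≡ true → bit a ≡ 1
bit-true refl = refl

bit-mono : ∀ {a b} → (a ≡ true → b ≡ true) → bit a ≤ bit b
bit-mono {false} i = z≤n
bit-mono {true}  i rewrite i refl = ≤-refl

count-witness : ∀ {A : Set} (p : A → Bool) xs → 0 < count p xs → ∃[ x ] p x ≡ true
count-witness p (x ∷ xs) c with p x in eq
... | true  = x , eq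
... | false = count-witness p xs c

count-excess : ∀ {A : Set} (p q : A → Bool) xs → count q xs < count p xs → ∃[ x ] (p x ≡ true × q x ≡ false)
count-excess p q xs lt with count-witness (λ x → p x ∧ not (q x)) xs
  (linear 0 (+-mono-≤ lt (∑-compare (bit ∘ p ∷ []) (bit ∘ q ∷ (λ x → bit (p x ∧ not (q x))) ∷ [])
                            (λ x → pointwise (p x) (q x)) xs))
            (arith (count p xs) (count q xs) _))
  where
  pointwise : ∀ a b → bit a + 0 ≤ bit b + (bit (a ∧ not b) + 0)
  pointwise true  true  = ≤-refl
  pointwise true  false = ≤-refl
  pointwise false b     = z≤n
  arith : ∀ p q r → 1 + (p + (q + (r + 0))) + 0 ≡ r + (suc q + (p + 0))
  arith = solve-∀
... | x , e = x , proj₁ (∧-true e) , not-true (proj₂ (∧-true {p x} e))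

module _ {n : ℕ} where

  infix 4 _==_
  _==_ : Fin n → Fin n → Bool
  u == v = ⌊ u ≟ v ⌋

  ==-refl : ∀ u → (u == u) ≡ true
  ==-refl u with u ≟ u
  ... | yes _ = refl
  ... | no ¬p = ⊥-elim (¬p refl)

  ==-sound : ∀ {u v} → (u == v) ≡ true → u ≡ v
  ==-sound {u} {v} e with u ≟ v
  ... | yes p = p

  # : (Fin n → Bool) → ℕ
  # p = count p (allFin n)

∑-allFin-suc : ∀ {n} (f : Fin (suc n) → ℕ) → ∑ f (allFin (suc n)) ≡ f Fin.zero + ∑ (f ∘ Fin.suc) (allFin n)
∑-allFin-suc f = cong (λ l → f Fin.zero + sum l)
  (trans (map-tabulate Fin.suc f) (sym (map-tabulate id (f ∘ Fin.suc))))

∑-select : ∀ {n} (u : Fin n) (p : Fin n → Bool) → # (λ v → (u == v) ∧ p v) ≡ bit (p u)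
∑-select {suc n} Fin.zero p = trans (∑-allFin-suc (λ v → bit ((Fin.zero == v) ∧ p v)))
  (trans (cong (bit (p Fin.zero) +_) (∑-zero (allFin n))) (+-identityʳ _))
∑-select {suc n} (Fin.suc u) p = trans (∑-allFin-suc (λ v → bit ((Fin.suc u == v) ∧ p v)))
  (trans (∑-cong (λ v → cong (λ b → bit (b ∧ p (Fin.suc v))) (suc-== u v)) (allFin n))
         (∑-select u (p ∘ Fin.suc)))
  where
  suc-== : ∀ (u v : Fin n) → (Fin.suc u == Fin.suc v) ≡ (u == v)
  suc-== u v with u ≟ v
  ... | yes _ = refl
  ... | no _  = refl

#-mono : ∀ {n} {p q : Fin n → Bool} → (∀ v → p v ≡ true → q v ≡ true) → # p ≤ # q
#-mono h = ∑-mono (λ v → bit-mono (h v)) (allFin _)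

#-singleton : ∀ {n} (u : Fin n) → # (u ==_) ≡ 1
#-singleton u = trans (∑-cong (λ v → cong bit (∧-true-right (u == v))) (allFin _)) (∑-select u (λ _ → true))
  where
  ∧-true-right : ∀ b → b ≡ b ∧ true
  ∧-true-right true  = refl
  ∧-true-right false = refl

#-full : ∀ n → # {n} (λ _ → true) ≡ n
#-full n = trans (∑-one (allFin n)) (length-tabulate id)

#-subsingleton : ∀ {n} (p : Fin n → Bool) → (∀ i j → p i ≡ true → p j ≡ true → i ≡ j) → # p ≤ 1
#-subsingleton p unique with # p in eq
... | zero  = z≤n
... | suc m with count-witness p (allFin _) (subst (0 <_) (sym eq) (s≤s z≤n))
...   | i , pi = subst (_≤ 1) eq (≤-trans
          (#-mono λ v pv → subst (λ t → (i == t) ≡ true) (unique i v pi pv) (==-refl i))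
          (≤-reflexive (#-singleton i)))

Distinct : ∀ {n} → List (Fin n) → Set
Distinct xs = ∀ v → count (_== v) xs ≤ 1

count-by-value : ∀ {n} (p : Fin n → Bool) xs →
                 count p xs ≡ ∑ (λ v → count (λ x → (x == v) ∧ p v) xs) (allFin n)
count-by-value p xs = trans (∑-cong (λ x → sym (∑-select x p)) xs)
                            (∑-swap (λ x v → bit ((x == v) ∧ p v)) xs (allFin _))

count-distinct : ∀ {n} (p : Fin n → Bool) xs → Distinct xs → count p xs ≤ # p
count-distinct p xs d = ≤-trans (≤-reflexive (count-by-value p xs)) (∑-mono pointwise (allFin _))
  where
  pointwise : ∀ v → count (λ x → (x == v) ∧ p v) xs ≤ bit (p v)
  pointwise v with p v
  ... | true  = ≤-trans (∑-mono (λ x → bit-mono λ e → proj₁ (∧-true e)) xs) (d v)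
  ... | false = ≤-trans (∑-mono (λ x → bit-mono λ e → proj₂ (∧-true {x == v} e)) xs) (≤-reflexive (∑-zero xs))

allFin-occurs-once : ∀ {n} (v : Fin n) → count (_== v) (allFin n) ≡ 1
allFin-occurs-once v = trans (∑-cong (λ x → ≤-antisym (flip-== x v) (flip-== v x)) (allFin _)) (#-singleton v)
  where
  flip-== : ∀ x v → bit (x == v) ≤ bit (v == x)
  flip-== x v = bit-mono λ e → subst (λ t → (t == x) ≡ true) (==-sound e) (==-refl x)

lookup-distinct : ∀ {A : Set} (p : A → Bool) xs → count p xs ≤ 1 → ∀ i j →
                  p (lookup xs i) ≡ true → p (lookup xs j) ≡ true → i ≡ j
lookup-distinct p (x ∷ xs) c Fin.zero    Fin.zero    pi pj = refl
lookup-distinct p (x ∷ xs) c (Fin.suc i) (Fin.suc j) pi pj =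
  cong Fin.suc (lookup-distinct p xs (m+n≤o⇒n≤o (bit (p x)) c) i j pi pj)
lookup-distinct p (x ∷ xs) c Fin.zero    (Fin.suc j) pi pj = ⊥-elim (two p xs x j c pi pj)
  where
  occurs : ∀ {A : Set} (p : A → Bool) xs j → p (lookup xs j) ≡ true → 1 ≤ count p xs
  occurs p (x ∷ xs) Fin.zero    e rewrite e = s≤s z≤n
  occurs p (x ∷ xs) (Fin.suc j) e = m≤n⇒m≤o+n (bit (p x)) (occurs p xs j e)
  two : ∀ {A : Set} (p : A → Bool) xs x j → count p (x ∷ xs) ≤ 1 → p x ≡ true → p (lookup xs j) ≡ true → ⊥
  two p xs x j c pi pj rewrite pi = <⇒≱ (s≤s (occurs p xs j pj)) c
lookup-distinct p (x ∷ xs) c (Fin.suc i) Fin.zero    pi pj = sym (lookup-distinct p (x ∷ xs) c Fin.zero (Fin.suc i) pj pi)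

bit-any : ∀ {A : Set} (p : A → Bool) xs → bit (any p xs) ≤ count p xs
bit-any p []       = z≤n
bit-any p (x ∷ xs) with p x
... | true  = s≤s z≤n
... | false = bit-any p xs

any-witness : ∀ {A : Set} (p : A → Bool) xs → any p xs ≡ true → ∃[ x ] p x ≡ true
any-witness p xs e = count-witness p xs (≤-trans (≤-reflexive (sym (bit-true e))) (bit-any p xs))

member : ∀ {n} → List (Fin n) → Fin n → Bool
member xs v = any (_== v) xs

#-member : ∀ {n} (xs : List (Fin n)) → # (member xs) ≤ length xs
#-member xs = begin
  # (member xs)                        ≤⟨ ∑-mono (λ v → bit-any (_== v) xs) (allFin _) ⟩
  ∑ (λ v → count (_== v) xs) (allFin _)  ≡⟨ sym (∑-swap (λ x v → bit (x == v)) xs (allFin _)) ⟩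
  ∑ (λ x → # (x ==_)) xs               ≡⟨ ∑-cong #-singleton xs ⟩
  ∑ (λ _ → 1) xs                       ≡⟨ ∑-one xs ⟩
  length xs                            ∎
  where open ≤-Reasoning

-- Hamiltonian cycles from closed paths

Path : ∀ {V : Set} → (V → V → Set) → V → List V → Set
Path R u []       = ⊤
Path R u (y ∷ ys) = R u y × Path R y ys

module _ {V : Set} {R : V → V → Set} where

  Path-++ : ∀ u xs ys → Path R u xs → Path R (end u xs) ys → Path R u (xs ++ ys)
  Path-++ u []       ys _       q = q
  Path-++ u (x ∷ xs) ys (r , p) q = r , Path-++ x xs ys p q

  Path-lookup : ∀ u ys (i j : Fin (length ys)) → Path R u ys → toℕ j ≡ suc (toℕ i) →
                R (lookup ys i) (lookup ys j)
  Path-lookup u (y ∷ z ∷ zs) Fin.zero    (Fin.suc Fin.zero) (_ , r , _) e = r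
  Path-lookup u (y ∷ ys)     (Fin.suc i) (Fin.suc j)        (_ , p)     e =
    Path-lookup y ys i j p (suc-injective e)

  Path-first : ∀ u ys (j : Fin (length ys)) → Path R u ys → toℕ j ≡ 0 → R u (lookup ys j)
  Path-first u (y ∷ ys) Fin.zero (r , _) e = r

zero-cost-path : ∀ {V : Set} {R : V → V → Set} (w : V → V → ℕ) → (∀ {u v} → w u v ≡ 0 → R u v) →
                 ∀ x xs → cost w x xs ≡ 0 → Path R x xs
zero-cost-path w f x []       c = tt
zero-cost-path w f x (y ∷ ys) c =
  f (m+n≡0⇒m≡0 (w x y) c) , zero-cost-path w f y ys (m+n≡0⇒n≡0 (w x y) c)

lookup-end : ∀ {V : Set} (u : V) ys (i : Fin (length ys)) → suc (toℕ i) ≡ length ys → lookup ys i ≡ end u ys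
lookup-end u (y ∷ [])     Fin.zero    e = refl
lookup-end u (y ∷ z ∷ zs) (Fin.suc i) e = lookup-end y (z ∷ zs) i (suc-injective e)

toℕ-next : ∀ {n} (i : Fin n) → toℕ (next i) ≡ suc (toℕ i) ⊎ (suc (toℕ i) ≡ n × toℕ (next i) ≡ 0)
toℕ-next {suc m} i with suc (toℕ i) <? suc m
... | yes p = inj₁ (toℕ-fromℕ< p)
... | no ¬p = inj₂ (≤-antisym (toℕ<n i) (≮⇒≥ ¬p) , refl)

next-injective : ∀ {n} {i j : Fin n} → next i ≡ next j → i ≡ j
next-injective {n} {i} {j} e with toℕ-next i | toℕ-next j
... | inj₁ p       | inj₁ q       = toℕ-injective (suc-injective (trans (sym p) (trans (cong toℕ e) q)))
... | inj₁ p       | inj₂ (_ , q) = ⊥-elim (1+n≢0 (trans (sym p) (trans (cong toℕ e) q)))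
... | inj₂ (_ , p) | inj₁ q       = ⊥-elim (1+n≢0 (trans (sym q) (trans (sym (cong toℕ e)) p)))
... | inj₂ (p , _) | inj₂ (q , _) = toℕ-injective (suc-injective (trans p (sym q)))

module _ {n : ℕ} {R : Fin n → Fin n → Set} (x : Fin n) (xs : List (Fin n))
         (path : Path R x xs) (closed : end x xs ≡ x) (spanning : xs ↭ allFin n) where

  private
    len : n ≡ length xs
    len = sym (trans (Perm.↭-length spanning) (length-tabulate id))

  -- The start `x` reappears as the last entry of `xs`, so `xs` alone lists the cycle and the
  -- wrap-around step is the first step of the path.
  cyclicOrder : Fin n → Fin n
  cyclicOrder i = lookup xs (cast len i)

  cyclicOrder-injective : ∀ {i j} → cyclicOrder i ≡ cyclicOrder j → i ≡ j
  cyclicOrder-injective {i} {j} e = toℕ-injective (begin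
    toℕ i             ≡⟨ sym (toℕ-cast len i) ⟩
    toℕ (cast len i)  ≡⟨ cong toℕ (lookup-distinct (_== v) xs once (cast len i) (cast len j)
                                    (==-refl v) (subst (λ t → (t == v) ≡ true) e (==-refl v))) ⟩
    toℕ (cast len j)  ≡⟨ toℕ-cast len j ⟩
    toℕ j             ∎)
    where
    open ≡-Reasoning
    v = cyclicOrder i
    once : count (_== v) xs ≤ 1
    once = ≤-reflexive (trans (∑-↭ (bit ∘ (_== v)) spanning) (allFin-occurs-once v))

  cyclicOrder-related : ∀ i → R (cyclicOrder i) (cyclicOrder (next i))
  cyclicOrder-related i with toℕ-next i
  ... | inj₁ e = Path-lookup x xs _ _ path
                   (trans (toℕ-cast len (next i)) (trans e (cong suc (sym (toℕ-cast len i)))))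
  ... | inj₂ (e , e₀) = subst (λ t → R t (cyclicOrder (next i)))
    (sym (trans (lookup-end x xs (cast len i) (trans (cong suc (toℕ-cast len i)) (trans e len))) closed))
    (Path-first x xs (cast len (next i)) path (trans (toℕ-cast len (next i)) e₀))

-- Deleting a Hamiltonian cycle

module _ {n : ℕ} {G : Graph n} (H : HamiltonianCycle G) where

  cycleEdge-witness : ∀ {u v} → cycleEdge H u v ≡ true →
    ∃[ i ] ((order H i ≡ u × order H (next i) ≡ v) ⊎ (order H i ≡ v × order H (next i) ≡ u))
  cycleEdge-witness {u} {v} e with any-witness _ (allFin n) e
  ... | i , eᵢ with (order H i == u) ∧ (order H (next i) == v) in eq
  ...   | true  = i , inj₁ (==-sound (proj₁ (∧-true eq)) , ==-sound (proj₂ (∧-true {order H i == u} eq)))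
  ...   | false = i , inj₂ (==-sound (proj₁ (∧-true eᵢ)) , ==-sound (proj₂ (∧-true {order H i == v} eᵢ)))

  -- Double counting: an index `i` contributes only if `u` is its vertex or the next one, and
  -- injectivity of `order` and `next` leaves one index for each.
  cycle-degree : ∀ u → # (cycleEdge H u) ≤ 2
  cycle-degree u = begin
    # (cycleEdge H u)
      ≤⟨ ∑-mono (λ v → bit-any (f v) (allFin n)) (allFin n) ⟩
    ∑ (λ v → count (f v) (allFin n)) (allFin n)
      ≤⟨ ∑-mono (λ v → ∑-mono (λ i → split-∨ (g₁ i v) (g₂ i v)) (allFin n)) (allFin n) ⟩
    ∑ (λ v → ∑ (λ i → bit (g₁ i v) + bit (g₂ i v)) (allFin n)) (allFin n)
      ≡⟨ ∑-swap (λ v i → bit (g₁ i v) + bit (g₂ i v)) (allFin n) (allFin n) ⟩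
    ∑ (λ i → ∑ (λ v → bit (g₁ i v) + bit (g₂ i v)) (allFin n)) (allFin n)
      ≡⟨ ∑-cong (λ i → trans (∑-+ (bit ∘ g₁ i) (bit ∘ g₂ i) (allFin n))
                             (cong₂ _+_ (select₁ i) (∑-select (order H i) _))) (allFin n) ⟩
    ∑ (λ i → bit (order H i == u) + bit (order H (next i) == u)) (allFin n)
      ≡⟨ ∑-+ _ _ (allFin n) ⟩
    # (λ i → order H i == u) + # (λ i → order H (next i) == u)
      ≤⟨ +-mono-≤ (#-subsingleton _ λ i j p q → injective H (trans (==-sound p) (sym (==-sound q))))
                  (#-subsingleton _ λ i j p q → next-injective (injective H (trans (==-sound p) (sym (==-sound q))))) ⟩
    2 ∎
    where
    open ≤-Reasoning
    g₁ g₂ : Fin n → Fin n → Bool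
    g₁  i v = (order H i == u) ∧ (order H (next i) == v)
    g₂  i v = (order H i == v) ∧ (order H (next i) == u)
    f : Fin n → Fin n → Bool
    f v i = g₁ i v ∨ g₂ i v
    split-∨ : ∀ a b → bit (a ∨ b) ≤ bit a + bit b
    split-∨ true  b = s≤s z≤n
    split-∨ false b = ≤-refl
    select₁ : ∀ i → # (g₁ i) ≡ bit (order H i == u)
    select₁ i with order H i == u
    ... | true  = #-singleton (order H (next i))
    ... | false = ∑-zero (allFin n)

  degree-loss : ∀ (A : Fin n → Bool) u → # (λ v → A v ∧ adj G u v) ≤ # (λ v → A v ∧ minusCycle G H u v) + 2
  degree-loss A u = linear 0
    (+-mono-≤ (cycle-degree u)
      (∑-compare (bit ∘ (λ v → A v ∧ adj G u v) ∷ [])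
                 (bit ∘ (λ v → A v ∧ minusCycle G H u v) ∷ bit ∘ cycleEdge H u ∷ [])
                 (λ v → pointwise (A v) (adj G u v) (cycleEdge H u v)) (allFin n)))
    (arith (# (λ v → A v ∧ adj G u v)) (# (λ v → A v ∧ minusCycle G H u v)) (# (cycleEdge H u)))
    where
    pointwise : ∀ a b c → bit (a ∧ b) + 0 ≤ bit (a ∧ b ∧ not c) + (bit c + 0)
    pointwise true  true  true  = ≤-refl
    pointwise true  true  false = ≤-refl
    pointwise true  false c     = z≤n
    pointwise false b     c     = z≤n
    arith : ∀ x y z → x + (2 + (y + (z + 0))) + 0 ≡ y + 2 + (z + (x + 0))
    arith = solve-∀

-- The summand of degree is a local function of Defs; it is reached through degrees in one-vertex graphs.
degree≡# : ∀ {n} (a : Fin n → Fin n → Bool) u → degree a u ≡ # (a u)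
degree≡# {n} a u = ∑-cong (λ v → trans (sym (+-identityʳ _)) (one-vertex (a u v))) (allFin n)
  where
  one-vertex : ∀ b → degree {1} (λ _ _ → b) Fin.zero ≡ bit b
  one-vertex true  = refl
  one-vertex false = refl

-- `R` remembers, in the direction of traversal, which kinds of step the cycle takes; later it tells
-- which edges between the two hulls are used.
HamiltonianCycleIn : ∀ {n} → Graph n → (Fin n → Fin n → Set) → Set
HamiltonianCycleIn G R = Σ (HamiltonianCycle G) λ H → ∀ i → R (order H i) (order H (next i))

fromClosedPath : ∀ {n} (G : Graph n) (R : Fin n → Fin n → Set) → (∀ {u v} → R u v → adj G u v ≡ true) →
  3 ≤ n → ∀ x xs → Path R x xs → end x xs ≡ x → xs ↭ allFin n → HamiltonianCycleIn G R
fromClosedPath G R R⇒adj n≥3 x xs p c s = record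
  { order     = cyclicOrder x xs p c s
  ; injective = cyclicOrder-injective x xs p c s
  ; atLeast3  = n≥3
  ; adjacent  = λ i → R⇒adj (cyclicOrder-related x xs p c s i)
  } , cyclicOrder-related x xs p c s

halfDegree : ∀ {n} (G : Graph n) → minDegreeAtLeastHalf G → ∀ u → n ≤ 2 * # (adj G u)
halfDegree {n} G δ u = subst (λ d → n ≤ 2 * d) (degree≡# (adj G) u) (δ u)

dirac : ∀ {n} (G : Graph n) → 3 ≤ n → minDegreeAtLeastHalf G → HamiltonianCycle G
dirac {suc m} G n≥3 δ = proj₁ (fromClosedPath G (λ u v → adj G u v ≡ true) id n≥3 x (proj₁ best)
    (zero-cost-path w bit-not-zero x (proj₁ best) (proj₂ (proj₂ best)))
    (trans (proj₂ (proj₁ (proj₂ best))) closed)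
    (↭-trans (proj₁ (proj₁ (proj₂ best))) spanning))
  where
  n = suc m
  x : Fin n
  x = Fin.zero
  start : List (Fin n)
  start = map Fin.suc (allFin m) ++ x ∷ []
  w : Fin n → Fin n → ℕ
  -- The cost of a closed path is its number of nonadjacent steps. On the diagonal it is 1 by
  -- irreflexivity, which yields `w-diag`.
  w u v = bit (not (adj G u v))
  w-diag : ∀ u v → w u v ≤ w u u + w v v
  w-diag u v rewrite irrefl G u = ≤-trans (bit≤1 _) (m≤m+n 1 _)
  open Exchange w (λ u v → cong (bit ∘ not) (Graph.sym G u v)) w-diag

  bit-not-zero : ∀ {b} → bit (not b) ≡ 0 → b ≡ true
  bit-not-zero {true} _ = refl
  bit-not-pos : ∀ {b} → 0 < bit (not b) → b ≡ false
  bit-not-pos {false} _ = refl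

  spanning : start ↭ allFin n
  spanning = ↭-trans (Perm.++-comm (map Fin.suc (allFin m)) (x ∷ []))
                     (prep x (↭-reflexive (map-tabulate id Fin.suc)))
  closed : end x start ≡ x
  closed = end-++ x (map Fin.suc (allFin m)) (x ∷ [])

  improve : ∀ ys → Rearrangement x start ys → 0 < cost w x ys →
            ∃[ zs ] (Rearrangement x ys zs × cost w x zs < cost w x ys)
  improve ys (p , e) c with positive-slot w x ys c
  ... | u , u′ , s , c′ with find-slot g h x ys enough
    where
    g = adj G u
    h = adj G u′
    ↭all : ys ↭ allFin n
    ↭all = ↭-trans p spanning
    sizes : count g (x ∷ ys) + count h ys ≡ bit (g x) + # g + # h
    sizes = cong₂ (λ a b → bit (g x) + a + b) (∑-↭ (bit ∘ g) ↭all) (∑-↭ (bit ∘ h) ↭all)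
    sizeˡ : length ys + bit (g (end x ys)) ≡ n + bit (g x)
    sizeˡ = cong₂ (λ a b → a + bit (g b)) (trans (Perm.↭-length ↭all) (length-tabulate id)) (trans e closed)
    -- Two degrees of sum n could fill the n slots without a common one. The missing unit is the
    -- slot `u u′` itself: `u` is not its own neighbour, nor is `u′`.
    free : 1 ≤ cost (neither g h) x ys
    free = subst (_≤ cost (neither g h) x ys)
      (cong₂ (λ a b → bit (not a ∧ not b)) (irrefl G u) (irrefl G u′)) (slot-cost (neither g h) s)
    half : n ≤ # g + # h
    half = *-cancelˡ-≤ 2 (≤-trans (≤-reflexive (double n)) (≤-trans
      (+-mono-≤ (halfDegree G δ u) (halfDegree G δ u′)) (≤-reflexive (sym (*-distribˡ-+ 2 (# g) (# h))))))
      where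
      double : ∀ n → 2 * n ≡ n + n
      double = solve-∀
    enough : length ys + bit (g (end x ys)) < count g (x ∷ ys) + count h ys + cost (neither g h) x ys
    enough = begin-strict
      length ys + bit (g (end x ys))      ≡⟨ sizeˡ ⟩
      n + bit (g x)                       ≤⟨ +-monoˡ-≤ (bit (g x)) half ⟩
      # g + # h + bit (g x)               ≡⟨ regroup (# g) (# h) (bit (g x)) ⟩
      bit (g x) + # g + # h + 0           <⟨ +-monoʳ-< (bit (g x) + # g + # h) free ⟩
      bit (g x) + # g + # h + cost (neither g h) x ys ≡⟨ cong (_+ cost (neither g h) x ys) (sym sizes) ⟩
      count g (x ∷ ys) + count h ys + cost (neither g h) x ys ∎
      where
      open ≤-Reasoning
      regroup : ∀ a b c → a + b + c ≡ c + a + b + 0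
      regroup = solve-∀
  ...   | v , v′ , s′ , gv , hv′ = exchange s s′ (subst₂ _<_
            (sym (cong₂ (λ a b → bit (not a) + bit (not b)) gv hv′))
            (sym (cong (bit ∘ not) (bit-not-pos c′))) (s≤s z≤n))

  best = minimise x start improve

-- Separations

Closed : ∀ {n} → (Fin n → Fin n → Bool) → (Fin n → Bool) → (Fin n → Bool) → Set
Closed a s c = ∀ p q → s p ≡ false → s q ≡ false → a p q ≡ true → c p ≡ true → c q ≡ true

-- A positive certificate that k-connectedness fails: outside the separator, `side` is a union of
-- components that contains `inner` and misses `outer`.
record Separation {n : ℕ} (a : Fin n → Fin n → Bool) (k : ℕ) : Set where
  field
    separator side   : Fin n → Bool
    small            : # separator < k
    closed           : Closed a separator side
    inner outer      : Fin n
    inner-free       : separator inner ≡ false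
    outer-free       : separator outer ≡ false
    inner-side       : side inner ≡ true
    outer-side       : side outer ≡ false

∣∣≡# : ∀ {n} (S : Subset n) → ∣ S ∣ ≡ # (Vec.lookup S)
∣∣≡# Vec.[] = refl
∣∣≡# (b Vec.∷ S) = trans (head b) (sym (∑-allFin-suc (bit ∘ Vec.lookup (b Vec.∷ S))))
  where
  head : ∀ b → ∣ b Vec.∷ S ∣ ≡ bit b + # (Vec.lookup S)
  head true  = cong suc (∣∣≡# S)
  head false = ∣∣≡# S

module _ {n : ℕ} {S : Subset n} {u : Fin n} where

  ∉⇒false : u ∉ S → Vec.lookup S u ≡ false
  ∉⇒false u∉S with Vec.lookup S u in eq
  ... | true  = ⊥-elim (u∉S (lookup⇒[]= u S eq))
  ... | false = refl

  false⇒∉ : Vec.lookup S u ≡ false → u ∉ S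
  false⇒∉ e u∈S = true≢false ([]=⇒lookup u∈S) e

closed-reach : ∀ {n} {a : Fin n → Fin n → Bool} {S c u v} →
               Closed a (Vec.lookup S) c → Reach a S u v → c u ≡ true → c v ≡ true
closed-reach closed (here _)       cu = cu
closed-reach {a = a} {S} closed (step u∉ e r) cu = closed-reach closed r (closed _ _ (∉⇒false u∉) (head-free r) e cu)
  where
  head-free : ∀ {u v} → Reach a S u v → Vec.lookup S u ≡ false
  head-free (here u∉)     = ∉⇒false u∉
  head-free (step u∉ _ _) = ∉⇒false u∉

separation-refutes : ∀ {n} {a : Fin n → Fin n → Bool} {k} → KConnected a k → Separation a k → ⊥
separation-refutes {n} {a} {k} (_ , reach) sep =
  true≢false (closed-reach closed′ (reach S (subst (_< k) (sym size) small) inner outer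
                           (outside inner-free) (outside outer-free)) inner-side) outer-side
  where
  open Separation sep
  S = Vec.tabulate separator
  lookup-S : ∀ v → Vec.lookup S v ≡ separator v
  lookup-S = lookup∘tabulate separator
  size : ∣ S ∣ ≡ # separator
  size = trans (∣∣≡# S) (∑-cong (cong bit ∘ lookup-S) (allFin n))
  outside : ∀ {v} → separator v ≡ false → v ∉ S
  outside {v} e = false⇒∉ (trans (lookup-S v) e)
  closed′ : Closed a (Vec.lookup S) side
  closed′ p q sp sq = closed p q (trans (sym (lookup-S p)) sp) (trans (sym (lookup-S q)) sq)

Reach-snoc : ∀ {n} {a : Fin n → Fin n → Bool} {S u p q} → Reach a S u p → q ∉ S → a p q ≡ true → Reach a S u q
Reach-snoc (here u∉)      q∉ e = step u∉ e (here q∉)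
Reach-snoc (step u∉ e′ r) q∉ e = step u∉ e′ (Reach-snoc r q∉ e)

#-insert : ∀ {n} (c : Fin n → Bool) q → c q ≡ false → suc (# c) ≤ # (λ v → c v ∨ (q == v))
#-insert c q cq = linear 0
  (+-mono-≤ (≤-reflexive (sym (#-singleton q)))
    (∑-compare (bit ∘ c ∷ bit ∘ (q ==_) ∷ []) (bit ∘ (λ v → c v ∨ (q == v)) ∷ [])
               (λ v → pointwise v) (allFin _)))
  (arith (# c) _ (# (q ==_)))
  where
  pointwise : ∀ v → bit (c v) + (bit (q == v) + 0) ≤ bit (c v ∨ (q == v)) + 0
  pointwise v with q == v in eq
  ... | true  rewrite sym (==-sound {u = q} eq) | cq = ≤-refl
  ... | false with c v
  ...   | true  = ≤-refl
  ...   | false = z≤n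
  arith : ∀ x y z → suc x + (z + (y + 0)) + 0 ≡ y + (1 + (x + (z + 0)))
  arith = solve-∀

-- The set `c` of vertices known to be reachable grows along edges leaving it, until it contains `v`
-- or no such edge is left. The fuel `m` bounds the number of vertices outside `c`, so it cannot run
-- out while `v` is missing.
reach-or-separation : ∀ {n} (a : Fin n → Fin n → Bool) (S : Subset n) u v → u ∉ S → v ∉ S →
  Reach a S u v ⊎ (∃[ c ] (Closed a (Vec.lookup S) c × c u ≡ true × c v ≡ false))
reach-or-separation {n} a S u v u∉ v∉ =
  grow n (u ==_) (λ w e → subst (Reach a S u) (==-sound e) (here u∉)) (==-refl u) (m≤n+m n _)
  where
  s = Vec.lookup S
  exit? : ∀ c → Dec (∃[ p ] ∃[ q ] (s p ≡ false × s q ≡ false × a p q ≡ true × c p ≡ true × c q ≡ false))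
  exit? c = any? λ p → any? λ q → (s p ≟ᵇ false) ×-dec (s q ≟ᵇ false) ×-dec (a p q ≟ᵇ true)
                                   ×-dec (c p ≟ᵇ true) ×-dec (c q ≟ᵇ false)
  grow : ∀ m c → (∀ w → c w ≡ true → Reach a S u w) → c u ≡ true → n ≤ # c + m →
         Reach a S u v ⊎ (∃[ c ] (Closed a s c × c u ≡ true × c v ≡ false))
  grow m c r cu le with c v in cv
  ... | true = inj₁ (r v cv)
  grow zero c r cu le | false = ⊥-elim (<⇒≱ (#-insert c v cv) (begin
      # (λ w → c w ∨ (v == w))  ≤⟨ ∑-mono (λ w → bit≤1 (c w ∨ (v == w))) (allFin n) ⟩
      ∑ (λ _ → 1) (allFin n)    ≡⟨ #-full n ⟩
      n                         ≤⟨ le ⟩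
      # c + 0                   ≡⟨ +-identityʳ _ ⟩
      # c                       ∎))
    where open ≤-Reasoning
  grow (suc m) c r cu le | false with exit? c
  ... | yes (p , q , sp , sq , apq , cp , cq) =
    grow m (λ w → c w ∨ (q == w)) r′ (cong (_∨ (q == u)) cu) (≤-trans le (begin
      # c + suc m                    ≡⟨ +-suc (# c) m ⟩
      suc (# c) + m                  ≤⟨ +-monoˡ-≤ m (#-insert c q cq) ⟩
      # (λ w → c w ∨ (q == w)) + m   ∎))
    where
    open ≤-Reasoning
    r′ : ∀ w → c w ∨ (q == w) ≡ true → Reach a S u w
    r′ w e with c w in cw
    ... | true  = r w cw
    ... | false = subst (Reach a S u) (==-sound e) (Reach-snoc (r p cp) (false⇒∉ sq) apq)
  ... | no none = inj₂ (c , closed , cu , cv)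
    where
    closed : Closed a s c
    closed p q sp sq apq cp with c q in cq
    ... | true  = refl
    ... | false = ⊥-elim (none (p , q , sp , sq , apq , cp , cq))

-- The dichotomy is constructive because all subsets and pairs of vertices are searched.
connected-or-separation : ∀ {n} (a : Fin n → Fin n → Bool) {k} → k < n → KConnected a k ⊎ Separation a k
connected-or-separation {n} a {k} k<n with anySubset? bad?
  where
  Separated : Subset n → Fin n → Fin n → Set
  Separated S u v = ∃[ c ] (Closed a (Vec.lookup S) c × c u ≡ true × c v ≡ false)
  Bad : Subset n → Set
  Bad S = ∣ S ∣ < k × ∃[ u ] ∃[ v ] (u ∉ S × v ∉ S × Separated S u v)
  bad? : ∀ S → Dec (Bad S)
  bad? S = (∣ S ∣ <? k) ×-dec any? λ u → any? λ v → bad-pair? u v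
    where
    bad-pair? : ∀ u v → Dec (u ∉ S × v ∉ S × Separated S u v)
    bad-pair? u v with u ∈? S | v ∈? S
    ... | yes u∈ | _      = no λ (u∉ , _) → u∉ u∈
    ... | no _   | yes v∈ = no λ (_ , v∉ , _) → v∉ v∈
    ... | no u∉  | no v∉ with reach-or-separation a S u v u∉ v∉
    ...   | inj₁ r = no λ (_ , _ , c , cl , cu , cv) → true≢false (closed-reach cl r cu) cv
    ...   | inj₂ s = yes (u∉ , v∉ , s)
... | yes (S , small , u , v , u∉ , v∉ , c , cl , cu , cv) = inj₂ record
  { separator = Vec.lookup S ; side = c ; small = subst (_< k) (∣∣≡# S) small ; closed = cl
  ; inner = u ; outer = v ; inner-free = ∉⇒false u∉ ; outer-free = ∉⇒false v∉
  ; inner-side = cu ; outer-side = cv }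
... | no ¬bad = inj₁ (k<n , λ S small u v u∉ v∉ →
    [ id , (λ s → ⊥-elim (¬bad (S , small , u , v , u∉ , v∉ , s))) ]′ (reach-or-separation a S u v u∉ v∉))

-- König's theorem

module _ {n : ℕ} where

  open import Data.List.Membership.DecPropositional (_≟_ {n}) using () renaming (_∈?_ to _∈ₗ?_)

  -- The pairs are edges of a bipartite graph on two copies of `Fin n`: uniqueness is asked of each
  -- coordinate separately.
  record Matching (E : List (Fin n × Fin n)) (k : ℕ) : Set where
    field
      edges        : List (Fin n × Fin n)
      size         : length edges ≡ k
      included     : ∀ {e} → e ∈ₗ edges → e ∈ₗ E
      left-unique  : Unique (map proj₁ edges)
      right-unique : Unique (map proj₂ edges)

  record Cover (E : List (Fin n × Fin n)) (k : ℕ) : Set where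
    constructor cover
    field
      left right : List (Fin n)
      small      : length left + length right < k
      covers     : ∀ {u v} → (u , v) ∈ₗ E → u ∈ₗ left ⊎ v ∈ₗ right

  unique-cons-++ : ∀ {x : Fin n} {as bs} → x ∉ₗ as → x ∉ₗ bs → Disjoint as bs →
                   Unique as → Unique bs → Unique (x ∷ as ++ bs)
  unique-cons-++ {x} {as} {bs} x∉as x∉bs dis ua ub =
    All.tabulate (λ z∈ e → [ x∉as , x∉bs ]′ (∈-++⁻ as (subst (_∈ₗ as ++ bs) (sym e) z∈)))
    ∷ᵖ Unique.++⁺ ua ub dis

  -- In the critical case a cover (P , Q) of E′ of size k misses the edge (x , y).  A small cover of
  -- the edges of E′ avoiding y and Q would complete to one of all edges, so these edges have a
  -- matching saturating P; likewise those avoiding x and P have one saturating Q; the two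
  -- matchings are disjoint from each other and from (x , y).
  könig-bounded : ∀ m E k → length E ≤ m → Matching E k ⊎ Cover E k
  könig-bounded m E zero _ = inj₁ record
    { edges = [] ; size = refl ; included = λ () ; left-unique = []ᵖ ; right-unique = []ᵖ }
  könig-bounded m [] (suc k) _ = inj₂ (cover [] [] (s≤s z≤n) λ ())
  könig-bounded (suc m) ((x , y) ∷ E′) (suc k) (s≤s le) with könig-bounded m E′ (suc k) le
  ... | inj₁ M = inj₁ record
    { edges = edges ; size = size ; included = there ∘ included
    ; left-unique = left-unique ; right-unique = right-unique }
    where open Matching M
  ... | inj₂ (cover P Q sm cov) with x ∈ₗ? P | y ∈ₗ? Q | length P + length Q <? k
  ... | yes x∈ | _ | _ = inj₂ (cover P Q sm λ { (here refl) → inj₁ x∈ ; (there e∈) → cov e∈ })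
  ... | no _ | yes y∈ | _ = inj₂ (cover P Q sm λ { (here refl) → inj₂ y∈ ; (there e∈) → cov e∈ })
  ... | no _ | no _ | yes lt = inj₂ (cover (x ∷ P) Q (s≤s lt)
    λ { (here refl) → inj₁ (here refl) ; (there e∈) → [ inj₁ ∘ there , inj₂ ]′ (cov e∈) })
  ... | no x∉ | no y∉ | no ≮ = combine
    (könig-bounded m E₁ (length P) (≤-trans (length-filter (λ e → ¬? (proj₂ e ∈ₗ? (y ∷ Q))) E′) le))
    (könig-bounded m E₂ (length Q) (≤-trans (length-filter (λ e → ¬? (proj₁ e ∈ₗ? (x ∷ P))) E′) le))
    where
    total : length P + length Q ≡ k
    total = ≤-antisym (≤-pred sm) (≮⇒≥ ≮)
    E₁ = filter (λ e → ¬? (proj₂ e ∈ₗ? (y ∷ Q))) E′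
    E₂ = filter (λ e → ¬? (proj₁ e ∈ₗ? (x ∷ P))) E′
    in₁ : ∀ {u v} → (u , v) ∈ₗ E₁ → (u , v) ∈ₗ E′ × u ∈ₗ P × v ∉ₗ (y ∷ Q)
    in₁ e∈ with ∈-filter⁻ (λ e → ¬? (proj₂ e ∈ₗ? (y ∷ Q))) {xs = E′} e∈
    ... | e∈′ , v∉ = e∈′ , [ id , (λ v∈ → ⊥-elim (v∉ (there v∈))) ]′ (cov e∈′) , v∉
    in₂ : ∀ {u v} → (u , v) ∈ₗ E₂ → (u , v) ∈ₗ E′ × u ∉ₗ (x ∷ P) × v ∈ₗ Q
    in₂ e∈ with ∈-filter⁻ (λ e → ¬? (proj₁ e ∈ₗ? (x ∷ P))) {xs = E′} e∈
    ... | e∈′ , u∉ = e∈′ , u∉ , [ (λ u∈ → ⊥-elim (u∉ (there u∈))) , id ]′ (cov e∈′)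

    cover-arith₁ : ∀ d₁ d₂ p q → d₁ + d₂ < p → d₁ + (d₂ + suc q) < suc (p + q)
    cover-arith₁ d₁ d₂ p q lt = linear 0 lt (arith d₁ d₂ p q)
      where
      arith : ∀ d₁ d₂ p q → suc (d₁ + (d₂ + suc q)) + p + 0 ≡ suc (p + q) + suc (d₁ + d₂)
      arith = solve-∀
    cover-arith₂ : ∀ d₁ d₂ p q → d₁ + d₂ < q → (d₁ + suc p) + d₂ < suc (p + q)
    cover-arith₂ d₁ d₂ p q lt = linear 0 lt (arith d₁ d₂ p q)
      where
      arith : ∀ d₁ d₂ p q → suc ((d₁ + suc p) + d₂) + q + 0 ≡ suc (p + q) + suc (d₁ + d₂)
      arith = solve-∀

    combine : Matching E₁ (length P) ⊎ Cover E₁ (length P) → Matching E₂ (length Q) ⊎ Cover E₂ (length Q) →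
              Matching ((x , y) ∷ E′) (suc k) ⊎ Cover ((x , y) ∷ E′) (suc k)
    combine (inj₂ (cover D₁ D₂ sm′ cov′)) _ = inj₂ (cover D₁ (D₂ ++ y ∷ Q)
      (subst₂ (λ a b → length D₁ + a < suc b) (sym (length-++ D₂)) total
        (cover-arith₁ (length D₁) (length D₂) (length P) (length Q) sm′)) covers)
      where
      covers : ∀ {u v} → (u , v) ∈ₗ ((x , y) ∷ E′) → u ∈ₗ D₁ ⊎ v ∈ₗ (D₂ ++ y ∷ Q)
      covers (here refl) = inj₂ (∈-++⁺ʳ D₂ (here refl))
      covers {u} {v} (there e∈) with v ∈ₗ? (y ∷ Q)
      ... | yes v∈ = inj₂ (∈-++⁺ʳ D₂ v∈)
      ... | no v∉  = [ inj₁ , inj₂ ∘ ∈-++⁺ˡ ]′ (cov′ (∈-filter⁺ (λ e → ¬? (proj₂ e ∈ₗ? (y ∷ Q))) e∈ v∉))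
    combine (inj₁ _) (inj₂ (cover D₁ D₂ sm′ cov′)) = inj₂ (cover (D₁ ++ x ∷ P) D₂
      (subst₂ (λ a b → a + length D₂ < suc b) (sym (length-++ D₁)) total
        (cover-arith₂ (length D₁) (length D₂) (length P) (length Q) sm′)) covers)
      where
      covers : ∀ {u v} → (u , v) ∈ₗ ((x , y) ∷ E′) → u ∈ₗ (D₁ ++ x ∷ P) ⊎ v ∈ₗ D₂
      covers (here refl) = inj₁ (∈-++⁺ʳ D₁ (here refl))
      covers {u} {v} (there e∈) with u ∈ₗ? (x ∷ P)
      ... | yes u∈ = inj₁ (∈-++⁺ʳ D₁ u∈)
      ... | no u∉  = [ inj₁ ∘ ∈-++⁺ˡ , inj₂ ]′ (cov′ (∈-filter⁺ (λ e → ¬? (proj₁ e ∈ₗ? (x ∷ P))) e∈ u∉))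
    combine (inj₁ M) (inj₁ N) = inj₁ record
      { edges        = (x , y) ∷ M.edges ++ N.edges
      ; size         = cong suc (trans (length-++ M.edges) (trans (cong₂ _+_ M.size N.size) total))
      ; included     = λ { (here e) → here e
                         ; (there e∈) → there ([ proj₁ ∘ in₁ ∘ M.included , proj₁ ∘ in₂ ∘ N.included ]′
                                                 (∈-++⁻ M.edges e∈)) }
      ; left-unique  = subst (λ l → Unique (x ∷ l)) (sym (map-++ proj₁ M.edges N.edges))
          (unique-cons-++ (x∉ ∘ leftM) (λ x∈ → leftN x∈ (here refl))
                          (λ (a , b) → leftN b (there (leftM a))) M.left-unique N.left-unique)
      ; right-unique = subst (λ l → Unique (y ∷ l)) (sym (map-++ proj₂ M.edges N.edges))
          (unique-cons-++ (λ y∈ → rightM y∈ (here refl)) (y∉ ∘ rightN)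
                          (λ (a , b) → rightM a (there (rightN b))) M.right-unique N.right-unique)
      }
      where
      module M = Matching M
      module N = Matching N
      leftM : ∀ {u} → u ∈ₗ map proj₁ M.edges → u ∈ₗ P
      leftM u∈ with ∈-map⁻ proj₁ u∈
      ... | e , e∈ , refl = proj₁ (proj₂ (in₁ (M.included e∈)))
      rightM : ∀ {v} → v ∈ₗ map proj₂ M.edges → v ∉ₗ (y ∷ Q)
      rightM v∈ with ∈-map⁻ proj₂ v∈
      ... | e , e∈ , refl = proj₂ (proj₂ (in₁ (M.included e∈)))
      leftN : ∀ {u} → u ∈ₗ map proj₁ N.edges → u ∉ₗ (x ∷ P)
      leftN u∈ with ∈-map⁻ proj₁ u∈
      ... | e , e∈ , refl = proj₁ (proj₂ (in₂ (N.included e∈)))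
      rightN : ∀ {v} → v ∈ₗ map proj₂ N.edges → v ∈ₗ Q
      rightN v∈ with ∈-map⁻ proj₂ v∈
      ... | e , e∈ , refl = proj₂ (proj₂ (in₂ (N.included e∈)))

  könig : ∀ E k → Matching E k ⊎ Cover E k
  könig E k = könig-bounded (length E) E k ≤-refl

-- Clusters: the sides of a separation

-- The core is one side of a separation by a set S of fewer than k vertices, crossed only by edges
-- of a Hamiltonian cycle; the hull adds the vertices of S with at least as many neighbours in
-- this core as in the other one.
record Cluster {n : ℕ} (G : Graph n) (k : ℕ) : Set where
  field
    core hull   : Fin n → Bool
    core⊆hull   : ∀ {v} → core v ≡ true → hull v ≡ true
    core-degree : ∀ {v} → core v ≡ true → n ≤ 2 * # (λ w → core w ∧ adj G v w) + (2 * k + 2)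
    hull-degree : ∀ {v} → hull v ≡ true → core v ≡ false → n ≤ 4 * # (λ w → core w ∧ adj G v w) + 2 * k
    core-upper  : 2 * # core ≤ n + 2
    core-lower  : n ≤ 2 * # core + 2 * k
    hull-upper  : suc (# hull) ≤ # core + k

halve : ∀ {a b} → 2 * a < 2 * b → a < b
halve {a} {b} = *-cancelˡ-< 2 a b

quarter : ∀ {a b} → 4 * a < 4 * b → a < b
quarter {a} {b} = *-cancelˡ-< 4 a b

slot-All : ∀ {V : Set} {P : V → Set} {x xs u u′} → All.All P (x ∷ xs) → Slot x xs u u′ → P u × P u′
slot-All (px ∷ᵃ py ∷ᵃ _)  (slot [] a refl refl)      = px , py
slot-All (px ∷ᵃ pxs)      (slot (y ∷ b) a refl refl) = slot-All pxs (slot b a refl refl)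

verticesOf : ∀ {n} → (Fin n → Bool) → List (Fin n)
verticesOf p = filterᵇ p (allFin _)

count-filterᵇ : ∀ {A : Set} (p f : A → Bool) xs → count f (filterᵇ p xs) ≡ count (λ v → p v ∧ f v) xs
count-filterᵇ p f []       = refl
count-filterᵇ p f (x ∷ xs) with p x
... | true  = cong (bit (f x) +_) (count-filterᵇ p f xs)
... | false = count-filterᵇ p f xs

length-filterᵇ : ∀ {A : Set} (p : A → Bool) xs → length (filterᵇ p xs) ≡ count p xs
length-filterᵇ p []       = refl
length-filterᵇ p (x ∷ xs) with p x
... | true  = cong suc (length-filterᵇ p xs)
... | false = length-filterᵇ p xs

∈-verticesOf : ∀ {n} {p : Fin n → Bool} {v} → p v ≡ true → v ∈ₗ verticesOf p
∈-verticesOf {p = p} {v} e = ∈-filter⁺ (T? ∘ p) (∈-allFin v) (subst T (sym e) tt)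

extract : ∀ {A : Set} {x : A} {xs} → x ∈ₗ xs → ∃[ ys ] x ∷ ys ↭ xs
extract {x = x} x∈ with ∈-∃++ x∈
... | as , bs , refl = as ++ bs , ↭-sym (Perm.shift x as bs)

path-order : ∀ {A : Set} {x y : A} {xs} → x ∈ₗ xs → y ∈ₗ xs → x ≢ y → ∃[ ys ] (x ∷ ys ↭ xs × end x ys ≡ y)
path-order {x = x} {y} x∈ y∈ x≢y with extract x∈
... | ys , p with Perm.∈-resp-↭ (↭-sym p) y∈
...   | here e    = ⊥-elim (x≢y (sym e))
...   | there y∈′ with extract y∈′
...     | zs , q = zs ++ y ∷ [] , ↭-trans (prep x (↭-trans (Perm.++-comm zs (y ∷ [])) q)) p , end-++ x zs (y ∷ [])

-- Hamiltonian paths in a hull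

module _ {n k : ℕ} {G : Graph n} (C : Cluster G k) (large : 6 * k + 10 ≤ n) where
  open Cluster C

  core-large : k < # core
  core-large = halve (linear (2 * k + 9) (+-mono-≤ core-lower large) (arith k n (# core)))
    where
    arith : ∀ k n c → suc (2 * k) + (2 * c + 2 * k + n) + (2 * k + 9) ≡ 2 * c + (n + (6 * k + 10))
    arith = solve-∀

  coreDegree : Fin n → ℕ
  coreDegree v = # (λ w → core w ∧ adj G v w)

  -- The margin `k + 2` allows for two neighbours lost to a Hamiltonian cycle and fewer than `k`
  -- lost to a separator.
  hull-degree-large : ∀ {v} → hull v ≡ true → core v ≡ false → k + 2 < coreDegree v
  hull-degree-large {v} hv cv = quarter {k + 2}
    (linear 1 (+-mono-≤ (hull-degree hv cv) large) (arith k n (coreDegree v)))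
    where
    arith : ∀ k n d → suc (4 * (k + 2)) + (4 * d + 2 * k + n) + 1 ≡ 4 * d + (n + (6 * k + 10))
    arith = solve-∀

  -- The two degrees sum to at least n - 2k - 2, while the hull has at most n/2 + k vertices.
  core-degrees-large : ∀ {u v} → core u ≡ true → core v ≡ true → # hull + 1 < coreDegree u + coreDegree v
  core-degrees-large {u} {v} cu cv = halve
    (linear 3 (+-mono-≤ (+-mono-≤ (core-degree cu) (core-degree cv))
                (+-mono-≤ (+-mono-≤ large core-upper) (*-monoʳ-≤ 2 hull-upper)))
              (arith k n (coreDegree u) (coreDegree v) (# hull) (# core)))
    where
    arith : ∀ k n d e h c → suc (2 * (h + 1)) + ((2 * d + (2 * k + 2) + (2 * e + (2 * k + 2)))
              + (n + (n + 2) + 2 * (c + k))) + 3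
            ≡ 2 * (d + e) + (n + n + (6 * k + 10 + 2 * c + 2 * suc h))
    arith = solve-∀

  private
    -- A pair outside the core costs 5, more than the two mixed non-edges (2 each) that may replace
    -- it; a mixed non-edge is replaced by an edge and possibly a non-edge (cost 1) within the core.
    weight : Bool → Bool → Bool → ℕ
    weight true  true  a = bit (not a)
    weight false false a = 5
    weight true  false a = bit (not a) * 2
    weight false true  a = bit (not a) * 2

    w : Fin n → Fin n → ℕ
    w u v = weight (core u) (core v) (adj G u v)

    w-sym : ∀ u v → w u v ≡ w v u
    w-sym u v rewrite Graph.sym G u v with core u | core v
    ... | true  | true  = refl
    ... | true  | false = refl
    ... | false | true  = refl
    ... | false | false = refl

    bound₁ : ∀ a → bit (not a) ≤ 1
    bound₁ a = bit≤1 (not a)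
    bound₂ : ∀ a → bit (not a) * 2 ≤ 2
    bound₂ a = *-monoˡ-≤ 2 (bit≤1 (not a))

    w-diag : ∀ u v → w u v ≤ w u u + w v v
    w-diag u v rewrite irrefl G u | irrefl G v with core u | core v
    ... | true  | true  = ≤-trans (bound₁ _) (s≤s z≤n)
    ... | true  | false = ≤-trans (bound₂ (adj G u v)) (s≤s (s≤s z≤n))
    ... | false | true  = ≤-trans (bound₂ (adj G u v)) (s≤s (s≤s z≤n))
    ... | false | false = m≤m+n 5 5

    weight-zero : ∀ a b c → weight a b c ≡ 0 → c ≡ true
    weight-zero true  true  true _ = refl
    weight-zero true  false true _ = refl
    weight-zero false true  true _ = refl
    weight-zero false false c ()
    weight-zero true  true  false ()
    weight-zero true  false false ()
    weight-zero false true  false ()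

    open Exchange w w-sym w-diag

    w-≡ : ∀ {u v a b c} → core u ≡ a → core v ≡ b → adj G u v ≡ c → w u v ≡ weight a b c
    w-≡ refl refl refl = refl

    w≤ : ∀ {u v a b c m} → core u ≡ a → core v ≡ b → adj G u v ≡ c → weight a b c ≤ m → w u v ≤ m
    w≤ p q r le = ≤-trans (≤-reflexive (w-≡ p q r)) le

    gain : ∀ {s t z z′} x y → s ≤ x → t ≤ y → z′ ≡ z → x + y < z → s + t < z′
    gain x y p q refl lt = ≤-<-trans (+-mono-≤ p q) lt

    mixed-degrees-large : ∀ {v} → hull v ≡ true → core v ≡ false → # hull + 1 < # core + coreDegree v
    mixed-degrees-large {v} hv cv =
      linear 2 (+-mono-≤ hull-upper (hull-degree-large hv cv)) (arith (# hull) (# core) k (coreDegree v))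
      where
      arith : ∀ h c k d → suc (h + 1) + (c + k + d) + 2 ≡ c + d + (suc h + suc (k + 2))
      arith = solve-∀

    core-twice-large : # hull + 1 < # core + # core
    core-twice-large = linear 0 (+-mono-≤ hull-upper core-large) (arith (# hull) (# core) k)
      where
      arith : ∀ h c k → suc (h + 1) + (c + k + c) + 0 ≡ c + c + (suc h + suc k)
      arith = solve-∀

    -- Candidates `g` for `v` and `h` for `v′` that make the exchange at `u u′` profitable. A
    -- spanning path of the hull has one slot fewer than vertices, and its last vertex is no tail
    -- and its first no head; so `many` forces a slot `v v′` with both properties.
    record Improver (u u′ : Fin n) : Set where
      field
        g h    : Fin n → Bool
        g⊆hull : ∀ {v} → g v ≡ true → hull v ≡ true
        h⊆hull : ∀ {v} → h v ≡ true → hull v ≡ true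
        many   : # hull + 1 < # g + # h
        better : ∀ {v v′} → g v ≡ true → h v′ ≡ true → w u v + w u′ v′ < w u u′

    improver : ∀ u u′ → hull u ≡ true → hull u′ ≡ true → 0 < w u u′ → Improver u u′
    improver u u′ hu hu′ pos = go (core u) (core u′) (adj G u u′) refl refl refl
      where
      go : ∀ a b c → core u ≡ a → core u′ ≡ b → adj G u u′ ≡ c → Improver u u′
      go true true false cu cu′ e = record
        { g = λ v → core v ∧ adj G u v ; h = λ v → core v ∧ adj G u′ v
        ; g⊆hull = core⊆hull ∘ proj₁ ∘ ∧-true ; h⊆hull = core⊆hull ∘ proj₁ ∘ ∧-true
        ; many = core-degrees-large cu cu′
        ; better = λ {v} {v′} gv hv′ → gain 0 0
            (w≤ cu (proj₁ (∧-true gv)) (proj₂ (∧-true {core v} gv)) z≤n)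
                  (w≤ cu′ (proj₁ (∧-true hv′)) (proj₂ (∧-true {core v′} hv′)) z≤n) (w-≡ cu cu′ e) (s≤s z≤n) }
      -- The degree bounds of `u` and `u′` together do not guarantee `many`. So `v` ranges over the
      -- whole core, at the price of a possible nonedge `u v` of cost 1, still below 2.
      go true false false cu cu′ e = record
        { g = core ; h = λ v → core v ∧ adj G u′ v
        ; g⊆hull = core⊆hull ; h⊆hull = core⊆hull ∘ proj₁ ∘ ∧-true
        ; many = mixed-degrees-large hu′ cu′
        ; better = λ {v} {v′} cv hv′ → gain 1 0
            (w≤ cu cv refl (bound₁ (adj G u v)))
                  (w≤ cu′ (proj₁ (∧-true hv′)) (proj₂ (∧-true {core v′} hv′)) z≤n) (w-≡ cu cu′ e) (s≤s (s≤s z≤n)) }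
      go false true false cu cu′ e = record
        { g = λ v → core v ∧ adj G u v ; h = core
        ; g⊆hull = core⊆hull ∘ proj₁ ∘ ∧-true ; h⊆hull = core⊆hull
        ; many = subst (# hull + 1 <_) (+-comm (# core) _) (mixed-degrees-large hu cu)
        ; better = λ {v} {v′} gv cv′ → gain 0 1
            (w≤ cu (proj₁ (∧-true gv)) (proj₂ (∧-true {core v} gv)) z≤n)
                  (w≤ cu′ cv′ refl (bound₁ (adj G u′ v′))) (w-≡ cu cu′ e) (s≤s (s≤s z≤n)) }
      go false false c cu cu′ e = record
        { g = core ; h = core ; g⊆hull = core⊆hull ; h⊆hull = core⊆hull
        ; many = core-twice-large
        ; better = λ {v} {v′} cv cv′ → gain 2 2
            (w≤ cu cv refl (bound₂ (adj G u v))) (w≤ cu′ cv′ refl (bound₂ (adj G u′ v′))) (w-≡ cu cu′ e) ≤-refl }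
      go true  true  true cu cu′ e = ⊥-elim (<⇒≢ pos (sym (w-≡ cu cu′ e)))
      go true  false true cu cu′ e = ⊥-elim (<⇒≢ pos (sym (w-≡ cu cu′ e)))
      go false true  true cu cu′ e = ⊥-elim (<⇒≢ pos (sym (w-≡ cu cu′ e)))

  hull-path : ∀ {x y} → hull x ≡ true → hull y ≡ true → x ≢ y →
    ∃[ ys ] (x ∷ ys ↭ verticesOf hull × end x ys ≡ y × Path (λ u v → adj G u v ≡ true) x ys)
  hull-path {x} {y} hx hy x≢y with path-order (∈-verticesOf hx) (∈-verticesOf hy) x≢y
  ... | start , spanning , ends with minimise x start improve
    where
    improve : ∀ ys → Rearrangement x start ys → 0 < cost w x ys →
              ∃[ zs ] (Rearrangement x ys zs × cost w x zs < cost w x ys)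
    improve ys (p , e) c with positive-slot w x ys c
    ... | u , u′ , s , pos with improver u u′ (proj₁ (slot-hull s)) (proj₂ (slot-hull s)) pos
      where
      all-hull : All.All (λ v → hull v ≡ true) (x ∷ ys)
      all-hull = Perm.All-resp-↭ (↭-sym (↭-trans (prep x p) spanning)) (All.tabulate λ {v} v∈ →
                   Equivalence.to T-≡ (proj₂ (∈-filter⁻ (T? ∘ hull) {xs = allFin n} v∈)))
      slot-hull : Slot x ys u u′ → hull u ≡ true × hull u′ ≡ true
      slot-hull = slot-All all-hull
    ...   | imp with find-slot g h x ys enough
      where
      open Improver imp
      ↭hull : x ∷ ys ↭ verticesOf hull
      ↭hull = ↭-trans (prep x p) spanning
      hull-count : ∀ f → (∀ {v} → f v ≡ true → hull v ≡ true) → # f ≤ count f (x ∷ ys)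
      hull-count f f⊆ = begin
        # f                          ≤⟨ #-mono {p = f} (λ v fv → true-∧ (f⊆ fv) fv) ⟩
        # (λ v → hull v ∧ f v)       ≡⟨ sym (count-filterᵇ hull f (allFin n)) ⟩
        count f (verticesOf hull)    ≡⟨ sym (∑-↭ (bit ∘ f) ↭hull) ⟩
        count f (x ∷ ys)             ∎
        where open ≤-Reasoning
      enough : length ys + bit (g (end x ys)) < count g (x ∷ ys) + count h ys + cost (neither g h) x ys
      enough = linear (cost (neither g h) x ys)
        (+-mono-≤ (+-mono-≤ many (≤-reflexive (trans (Perm.↭-length ↭hull) (length-filterᵇ hull (allFin n)))))
                  (+-mono-≤ (+-mono-≤ (hull-count g g⊆hull) (hull-count h h⊆hull))
                            (+-mono-≤ (bit≤1 (g (end x ys))) (bit≤1 (h x)))))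
        (arith (length ys) (bit (g (end x ys))) (# g) (# h) (# hull) (count g (x ∷ ys)) (bit (h x)) (count h ys) _)
        where
        arith : ∀ l e g h H p b q r →
          suc (l + e) + (g + h + H + (p + (b + q) + 2)) + r ≡ p + q + r + (suc (H + 1) + suc l + (g + h + (e + b)))
        arith = solve-∀
    ...     | v , v′ , s′ , gv , hv′ = exchange s s′ (Improver.better imp gv hv′)
  ...   | ys , (p , e) , c =
    ys , ↭-trans (prep x p) spanning , trans e ends , zero-cost-path w (λ {u} {v} → weight-zero (core u) (core v) _) x ys c

-- Hulls under the deletion of a cycle and of few vertices

module _ {n k : ℕ} {G : Graph n} (C : Cluster G k) (large : 6 * k + 10 ≤ n)
         {b : Fin n → Fin n → Bool} (b-sym : ∀ u v → b u v ≡ b v u) (b-irrefl : ∀ u → b u u ≡ false)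
         (loss : ∀ (A : Fin n → Bool) u → # (λ v → A v ∧ adj G u v) ≤ # (λ v → A v ∧ b u v) + 2)
         {s c : Fin n → Bool} (s-small : # s < k) (closed : Closed b s c) where
  open Cluster C

  private
    closed-back : ∀ {p q} → s p ≡ false → s q ≡ false → b p q ≡ true → c p ≡ false → c q ≡ false
    closed-back {p} {q} sp sq e cp with c q in cq
    ... | true  = true≢false (closed q p sq sp (trans (b-sym q p) e) cq) cp
    ... | false = refl

    keptDegree : Fin n → ℕ
    keptDegree u = # (λ v → core v ∧ b u v)

  -- Two core vertices on different sides would have too many common neighbours.
  core-one-sided : ∀ {u v} → core u ≡ true → core v ≡ true → s u ≡ false → s v ≡ false →
                   c u ≡ true → c v ≡ false → ⊥
  core-one-sided {u} {v} cu cv su sv u-side v-side = <⇒≱ absurd large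
    where
    u≢v : ∀ w → (u == w) ≡ true → (v == w) ≡ true → ⊥
    u≢v w p q with ==-sound {u = u} p | ==-sound {u = v} q
    ... | refl | refl = true≢false u-side v-side
    -- Lying on different sides, `u` and `v` are nonadjacent in `b` and share no neighbour outside
    -- `s`. Hence a core vertex is counted once on the left, or twice if it lies in `s`.
    pointwise : ∀ w → bit (core w ∧ b u w) + (bit (core w ∧ b v w) + (bit (u == w) + (bit (v == w) + 0)))
                      ≤ bit (core w) + (bit (s w) + 0)
    pointwise w with u == w in uw | v == w in vw
    ... | true  | true  = ⊥-elim (u≢v w uw vw)
    ... | true  | false with ==-sound {u = u} uw
    ...   | refl rewrite cu | b-irrefl u with b v u in vu
    ...     | true  = true≢false u-side (closed-back sv su vu v-side)
    ...     | false = s≤s z≤n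
    pointwise w | false | true with ==-sound {u = v} vw
    ...   | refl rewrite cv | b-irrefl v with b u v in e
    ...     | true  = true≢false (closed u v su sv e u-side) v-side
    ...     | false = s≤s z≤n
    pointwise w | false | false with core w
    ... | false = z≤n
    ... | true with b u w in uw′ | b v w in vw′ | s w in sw
    ...   | true  | true  | true  = ≤-refl
    ...   | true  | true  | false =
      true≢false (closed u w su sw uw′ u-side) (closed-back sv sw vw′ v-side)
    ...   | true  | false | _ = s≤s z≤n
    ...   | false | true  | _ = s≤s z≤n
    ...   | false | false | _ = z≤n
    total : keptDegree u + (keptDegree v + (1 + (1 + 0))) ≤ # core + (# s + 0)
    total = subst₂ (λ x y → keptDegree u + (keptDegree v + (x + (y + 0))) ≤ # core + (# s + 0))
      (#-singleton u) (#-singleton v)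
      (∑-compare (bit ∘ (λ w → core w ∧ b u w) ∷ bit ∘ (λ w → core w ∧ b v w)
                  ∷ bit ∘ (u ==_) ∷ bit ∘ (v ==_) ∷ [])
                 (bit ∘ core ∷ bit ∘ s ∷ []) pointwise (allFin n))
    absurd : n < 6 * k + 10
    absurd = linear 1
      (+-mono-≤ (+-mono-≤ (+-mono-≤ (core-degree cu) (core-degree cv))
                          (*-monoʳ-≤ 2 (+-mono-≤ (loss core u) (loss core v))))
                (+-mono-≤ (*-monoʳ-≤ 2 total) (+-mono-≤ core-upper (*-monoʳ-≤ 2 s-small))))
      (arith n k (# (λ w → core w ∧ adj G u w)) (# (λ w → core w ∧ adj G v w))
             (keptDegree u) (keptDegree v) (# core) (# s))
      where
      arith : ∀ n k d e d′ e′ c s →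
        suc n + ((2 * d + (2 * k + 2) + (2 * e + (2 * k + 2)) + 2 * (d′ + 2 + (e′ + 2)))
                 + (2 * (c + (s + 0)) + (n + 2 + 2 * k))) + 1
        ≡ 6 * k + 10 + (n + n + 2 * (d + e) + (2 * (d′ + (e′ + 2)) + (2 * c + 2 * suc s)))
      arith = solve-∀

  keptDegree-large : ∀ {x} → hull x ≡ true → core x ≡ false → # s < keptDegree x
  keptDegree-large {x} hx cx = linear 1 (+-mono-≤ s-small (+-mono-≤ (hull-degree-large C large hx cx) (loss core x)))
    (arith (# s) (keptDegree x) k (# (λ v → core v ∧ adj G x v)))
    where
    arith : ∀ s d′ k d → suc s + (k + (d + (d′ + 2))) + 1 ≡ d′ + (suc s + (suc (k + 2) + d))
    arith = solve-∀

  same-side : ∀ {x y} → s x ≡ false → s y ≡ false → b x y ≡ true → c y ≡ c x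
  same-side {x} {y} sx sy e = go (c x) refl
    where
    go : ∀ a → c x ≡ a → c y ≡ c x
    go true  cx = trans (closed x y sx sy e cx) (sym cx)
    go false cx = trans (closed-back sx sy e cx) (sym cx)

  -- A hull vertex outside the core keeps more core neighbours than `s` has vertices, so one of them
  -- avoids `s` and carries the side of `x`.
  core-neighbour : ∀ {x} → hull x ≡ true → s x ≡ false → ∃[ y ] (core y ≡ true × s y ≡ false × c y ≡ c x)
  core-neighbour {x} hx sx = go (core x) refl
    where
    go : ∀ a → core x ≡ a → ∃[ y ] (core y ≡ true × s y ≡ false × c y ≡ c x)
    go true  cx = x , cx , sx , refl
    go false cx = let (y , e , sy) = count-excess (λ v → core v ∧ b x v) s (allFin n) (keptDegree-large hx cx) in
      y , proj₁ (∧-true e) , sy , same-side sx sy (proj₂ (∧-true {core y} e))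

  hull-one-sided : ∀ {x y} → hull x ≡ true → hull y ≡ true → s x ≡ false → s y ≡ false → c x ≡ c y
  hull-one-sided {x} {y} hx hy sx sy with core-neighbour hx sx | core-neighbour hy sy
  ... | u , cu , su , ux | v , cv , sv , vy with c u in eu | c v in ev
  ...   | true  | true  = trans (sym ux) vy
  ...   | false | false = trans (sym ux) vy
  ...   | true  | false = ⊥-elim (core-one-sided cu cv su sv eu ev)
  ...   | false | true  = ⊥-elim (core-one-sided cv cu sv su ev eu)

-- From a separation to a pair of clusters

minusCycle-sym : ∀ {n} (G : Graph n) (H : HamiltonianCycle G) u v → minusCycle G H u v ≡ minusCycle G H v u
minusCycle-sym G H u v = cong₂ (λ a b → a ∧ not b) (Graph.sym G u v)
  (cong or (map-cong (λ i → ∨-comm ((order H i == u) ∧ (order H (next i) == v)) _) (allFin _)))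

minusCycle-irrefl : ∀ {n} (G : Graph n) (H : HamiltonianCycle G) u → minusCycle G H u u ≡ false
minusCycle-irrefl G H u rewrite irrefl G u = refl

record ClusterPair {n : ℕ} (G : Graph n) (k : ℕ) : Set where
  field
    X Y           : Cluster G k
    complementary : ∀ v → Cluster.hull Y v ≡ not (Cluster.hull X v)

-- One side `A` of the separation by `s`, stated so that it also applies with `A` and `B` exchanged;
-- `b` is to be the graph without the cycle.
module Side {n k : ℕ} (G : Graph n) (half : ∀ u → n ≤ 2 * # (adj G u)) (b : Fin n → Fin n → Bool)
  (loss : ∀ (A : Fin n → Bool) u → # (λ v → A v ∧ adj G u v) ≤ # (λ v → A v ∧ b u v) + 2)
  (A B s : Fin n → Bool) (partition : ∀ v → bit (A v) + (bit (B v) + (bit (s v) + 0)) ≡ 1)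
  (separated : ∀ p q → A p ≡ true → B q ≡ true → b p q ≡ false) where

  dA dB : Fin n → ℕ
  dA v = # (λ w → A w ∧ adj G v w)
  dB v = # (λ w → B w ∧ adj G v w)

  total : # A + (# B + (# s + 0)) ≡ n
  total = trans (∑-swap id (bit ∘ A ∷ bit ∘ B ∷ bit ∘ s ∷ []) (allFin n))
                (trans (∑-cong partition (allFin n)) (#-full n))

  degree-split : ∀ v → # (adj G v) ≤ dA v + dB v + # s
  degree-split v = linear 0
    (∑-compare (bit ∘ adj G v ∷ []) (bit ∘ (λ w → A w ∧ adj G v w) ∷ bit ∘ (λ w → B w ∧ adj G v w) ∷ bit ∘ s ∷ [])
               (λ w → pointwise (A w) (B w) (s w) (adj G v w) (partition w)) (allFin n))
    (arith (# (adj G v)) (dA v) (dB v) (# s))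
    where
    pointwise : ∀ a b s e → bit a + (bit b + (bit s + 0)) ≡ 1 → bit e + 0 ≤ bit (a ∧ e) + (bit (b ∧ e) + (bit s + 0))
    pointwise a     b     s     false _ = z≤n
    pointwise true  b     s     true  _ = s≤s z≤n
    pointwise false true  s     true  _ = s≤s z≤n
    pointwise false false true  true  _ = s≤s z≤n
    arith : ∀ e a b s → e + (a + (b + (s + 0))) + 0 ≡ a + b + s + (e + 0)
    arith = solve-∀

  -- All neighbours across are lost in passing to `b`, and a vertex loses at most two.
  few-across : ∀ {v} → A v ≡ true → dB v ≤ 2
  few-across {v} Av = ≤-trans (loss B v) (≤-reflexive (cong (_+ 2) (trans
    (∑-cong none (allFin n)) (∑-zero (allFin n)))))
    where
    none : ∀ w → bit (B w ∧ b v w) ≡ 0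
    none w with B w in Bw
    ... | false = refl
    ... | true  = cong bit (separated v w Av Bw)

  degree-within : ∀ {v} → A v ≡ true → n ≤ 2 * dA v + 2 * # s + 4
  degree-within {v} Av = linear 0
    (+-mono-≤ (half v) (*-monoʳ-≤ 2 (+-mono-≤ (degree-split v) (few-across Av))))
    (arith n (# (adj G v)) (dA v) (dB v) (# s))
    where
    arith : ∀ n e a b s → n + (2 * e + 2 * (a + b + s + 2)) + 0 ≡ 2 * a + 2 * s + 4 + (n + 2 * (e + b))
    arith = solve-∀

  size-lower : ∀ {v} → A v ≡ true → n ≤ 2 * # A + 2 * # s + 2
  size-lower {v} Av = linear 0 (+-mono-≤ (degree-within Av) (*-monoʳ-≤ 2 not-self)) (arith n (dA v) (# A) (# s))
    where
    pointwise : ∀ w → bit (A w ∧ adj G v w) + (bit (v == w) + 0) ≤ bit (A w) + 0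
    pointwise w with v == w in e
    ... | true with ==-sound {u = v} e
    ...   | refl rewrite Av | irrefl G v = ≤-refl
    pointwise w | false with A w | adj G v w
    ... | true  | true  = ≤-refl
    ... | true  | false = z≤n
    ... | false | _     = z≤n
    not-self : dA v + (1 + 0) ≤ # A + 0
    not-self = subst (λ o → dA v + (o + 0) ≤ # A + 0) (#-singleton v)
      (∑-compare (bit ∘ (λ w → A w ∧ adj G v w) ∷ bit ∘ (v ==_) ∷ []) (bit ∘ A ∷ []) pointwise (allFin n))
    arith : ∀ n d a s → n + (2 * d + 2 * s + 4 + 2 * (a + 0)) + 0 ≡ 2 * a + 2 * s + 2 + (n + 2 * (d + (1 + 0)))
    arith = solve-∀

  -- The factor 4 in `hull-degree`: of the at least n/2 - |s| neighbours outside `s`, half lie in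
  -- the preferred core. The upper bound on `A` comes from the lower bound on `B`.
  cluster : (prefer : Fin n → Bool) → (∀ v → prefer v ≡ true → dB v ≤ dA v) → # s < k →
            ∃[ v ] A v ≡ true → n ≤ 2 * # B + 2 * # s + 2 → Cluster G k
  cluster prefer preferred small (a , Aa) other-lower = record
    { core        = A
    ; hull        = hull
    ; core⊆hull   = λ {v} Av → cong (_∨ (s v ∧ prefer v)) Av
    ; core-degree = λ {v} Av → linear 0 (+-mono-≤ (degree-within Av) (*-monoʳ-≤ 2 small)) (arith₁ n k (dA v) (# s))
    ; hull-degree = λ {v} hv Av → linear 2
        (+-mono-≤ (+-mono-≤ (half v) (*-monoʳ-≤ 2 (degree-split v)))
                  (*-monoʳ-≤ 2 (+-mono-≤ (preferred v (proj₂ (∧-true {s v} (outside (A v) hv Av)))) small)))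
        (arith₂ n k (# (adj G v)) (dA v) (dB v) (# s))
    ; core-upper  = linear 0 (+-mono-≤ other-lower (*-monoʳ-≤ 2 (≤-reflexive total))) (arith₃ n (# A) (# B) (# s))
    ; core-lower  = linear 0 (+-mono-≤ (size-lower Aa) (*-monoʳ-≤ 2 small)) (arith₄ n k (# A) (# s))
    ; hull-upper  = linear 0 (+-mono-≤ small hull-size) (arith₅ k (# hull) (# A) (# s))
    }
    where
    hull : Fin n → Bool
    hull v = A v ∨ (s v ∧ prefer v)
    outside : ∀ a {b} → a ∨ b ≡ true → a ≡ false → b ≡ true
    outside false e _ = e
    hull-size : # hull + 0 ≤ # A + (# s + 0)
    hull-size = ∑-compare (bit ∘ hull ∷ []) (bit ∘ A ∷ bit ∘ s ∷ [])
      (λ v → pointwise (A v) (s v) (prefer v)) (allFin n)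
      where
      pointwise : ∀ a s p → bit (a ∨ (s ∧ p)) + 0 ≤ bit a + (bit s + 0)
      pointwise true  s     p     = s≤s z≤n
      pointwise false true  true  = ≤-refl
      pointwise false true  false = z≤n
      pointwise false false p     = z≤n
    arith₁ : ∀ n k d s → n + (2 * d + 2 * s + 4 + 2 * k) + 0 ≡ 2 * d + (2 * k + 2) + (n + 2 * suc s)
    arith₁ = solve-∀
    arith₂ : ∀ n k e d f s → n + (2 * e + 2 * (d + f + s) + 2 * (d + k)) + 2
                             ≡ 4 * d + 2 * k + (n + 2 * e + 2 * (f + suc s))
    arith₂ = solve-∀
    arith₃ : ∀ n a b s → 2 * a + (2 * b + 2 * s + 2 + 2 * n) + 0 ≡ n + 2 + (n + 2 * (a + (b + (s + 0))))
    arith₃ = solve-∀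
    arith₄ : ∀ n k a s → n + (2 * a + 2 * s + 2 + 2 * k) + 0 ≡ 2 * a + 2 * k + (n + 2 * suc s)
    arith₄ = solve-∀
    arith₅ : ∀ k h a s → suc h + (k + (a + (s + 0))) + 0 ≡ a + k + (suc s + (h + 0))
    arith₅ = solve-∀

separation-clusters : ∀ {n k} (G : Graph n) → (∀ u → n ≤ 2 * # (adj G u)) → (H : HamiltonianCycle G) →
                      Separation (minusCycle G H) k → ClusterPair G k
separation-clusters {n} {k} G half H sep = record
  { X = XSide.cluster prefer (λ v e → ≤ᵇ⇒≤ (XSide.dB v) (XSide.dA v) (Equivalence.from T-≡ e))
                      small (inner , A-inner) (YSide.size-lower B-outer)
  ; Y = YSide.cluster (not ∘ prefer) (λ v e → <⇒≤ (≰⇒> λ le → true≢false (Equivalence.to T-≡ (≤⇒≤ᵇ le)) (not-true e)))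
                      small (outer , B-outer) (XSide.size-lower A-inner)
  ; complementary = λ v → complement (s v) (side v) (prefer v)
  }
  where
  open Separation sep renaming (separator to s)
  b = minusCycle G H
  A B : Fin n → Bool
  A v = not (s v) ∧ side v
  B v = not (s v) ∧ not (side v)
  apart : ∀ p q → A p ≡ true → B q ≡ true → b p q ≡ false
  apart p q Ap Bq with b p q in e
  ... | false = refl
  ... | true  = true≢false
    (closed p q (not-true (proj₁ (∧-true Ap))) (not-true (proj₁ (∧-true Bq))) e (proj₂ (∧-true {not (s p)} Ap)))
    (not-true (proj₂ (∧-true {not (s q)} Bq)))
  partition₁ : ∀ s c → bit (not s ∧ c) + (bit (not s ∧ not c) + (bit s + 0)) ≡ 1
  partition₁ true  c     = refl
  partition₁ false true  = refl
  partition₁ false false = refl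
  partition₂ : ∀ s c → bit (not s ∧ not c) + (bit (not s ∧ c) + (bit s + 0)) ≡ 1
  partition₂ true  c     = refl
  partition₂ false true  = refl
  partition₂ false false = refl
  module XSide = Side {k = k} G half b (degree-loss H) A B s (λ v → partition₁ (s v) (side v)) apart
  module YSide = Side {k = k} G half b (degree-loss H) B A s (λ v → partition₂ (s v) (side v))
    (λ p q Bp Aq → trans (minusCycle-sym G H p q) (apart q p Aq Bp))
  prefer : Fin n → Bool
  -- A tie goes to the hull of `X`; that of `Y` takes the strict case, so the hulls are
  -- complementary.
  prefer v = XSide.dB v ≤ᵇ XSide.dA v
  A-inner : A inner ≡ true
  A-inner = true-∧ (cong not inner-free) inner-side
  B-outer : B outer ≡ true
  B-outer = true-∧ (cong not outer-free) (cong not outer-side)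
  complement : ∀ s c p → (not s ∧ not c) ∨ (s ∧ not p) ≡ not ((not s ∧ c) ∨ (s ∧ p))
  complement true  c     p = refl
  complement false true  p = refl
  complement false false p = refl

-- Crossing edges

∈⇒member : ∀ {n} {v : Fin n} {xs} → v ∈ₗ xs → member xs v ≡ true
∈⇒member {v = v} {x ∷ xs} (here refl) = cong (_∨ member xs v) (==-refl v)
∈⇒member {v = v} {x ∷ xs} (there v∈) with x == v
... | true  = refl
... | false = ∈⇒member v∈

member-∷ : ∀ {n} {x v : Fin n} {xs} → member (x ∷ xs) v ≡ false → x ≢ v × member xs v ≡ false
member-∷ {x = x} {v} e with x == v in eq
... | false = (λ { refl → true≢false (==-refl x) eq }) , e

pick : ∀ {n} (p : Fin n → Bool) xs → length xs < # p → ∃[ v ] (p v ≡ true × member xs v ≡ false)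
pick p xs lt = count-excess p (member xs) (allFin _) (≤-<-trans (#-member xs) lt)

-- With W the set of ends of a matching, these edges lie outside the matching.
record SpareEdges {n : ℕ} (G : Graph n) (p q : Fin n → Bool) (W : List (Fin n)) : Set where
  field
    x₁ x₂ y₁ y₂ : Fin n
    px₁    : p x₁ ≡ true
    px₂    : p x₂ ≡ true
    qy₁    : q y₁ ≡ true
    qy₂    : q y₂ ≡ true
    x₁≢x₂  : x₁ ≢ x₂
    y₁≢y₂  : y₁ ≢ y₂
    edge₁  : adj G x₁ y₁ ≡ true
    edge₂  : adj G x₂ y₂ ≡ true
    spare₁ : member W x₁ ≡ false ⊎ member W y₁ ≡ false
    spare₂ : member W x₂ ≡ false ⊎ member W y₂ ≡ false

swap-spare : ∀ {n} {G : Graph n} {p q W} → SpareEdges G p q W → SpareEdges G q p W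
swap-spare {G = G} E = record
  { px₁ = qy₁ ; px₂ = qy₂ ; qy₁ = px₁ ; qy₂ = px₂ ; x₁≢x₂ = y₁≢y₂ ; y₁≢y₂ = x₁≢x₂
  ; edge₁ = trans (Graph.sym G _ _) edge₁ ; edge₂ = trans (Graph.sym G _ _) edge₂
  ; spare₁ = [ inj₂ , inj₁ ]′ spare₁ ; spare₂ = [ inj₂ , inj₁ ]′ spare₂ }
  where open SpareEdges E

module _ {n : ℕ} (G : Graph n) (half : ∀ u → n ≤ 2 * # (adj G u)) where

  crossDegree : (Fin n → Bool) → Fin n → ℕ
  crossDegree q x = # (λ v → q v ∧ adj G x v)

  -- At most `# p - 1` neighbours of `x` lie on its own side. So at least one neighbour is across if
  -- `p` has at most half of the vertices, and at least two if it has less than half.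
  crossing-degree : ∀ p q → (∀ v → q v ≡ not (p v)) → ∀ {x} → p x ≡ true → n + 2 ≤ 2 * # p + 2 * crossDegree q x
  crossing-degree p q compl {x} px = linear 0 (+-mono-≤ (half x) (*-monoʳ-≤ 2 split))
    (arith n (# p) (crossDegree q x) (# (adj G x)))
    where
    pointwise : ∀ w → bit (adj G x w) + (bit (x == w) + 0) ≤ bit (p w) + (bit (q w ∧ adj G x w) + 0)
    pointwise w with x == w in e
    ... | true with ==-sound {u = x} e
    ...   | refl rewrite px | irrefl G x = s≤s z≤n
    pointwise w | false rewrite compl w with p w | adj G x w
    ... | true  | true  = s≤s z≤n
    ... | true  | false = z≤n
    ... | false | true  = ≤-refl
    ... | false | false = z≤n
    split : # (adj G x) + (1 + 0) ≤ # p + (crossDegree q x + 0)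
    split = subst (λ o → # (adj G x) + (o + 0) ≤ # p + (crossDegree q x + 0)) (#-singleton x)
      (∑-compare (bit ∘ adj G x ∷ bit ∘ (x ==_) ∷ []) (bit ∘ p ∷ bit ∘ (λ v → q v ∧ adj G x v) ∷ []) pointwise (allFin n))
    arith : ∀ n p d e → n + 2 + (2 * e + 2 * (p + (d + 0))) + 0 ≡ 2 * p + 2 * d + (n + 2 * (e + (1 + 0)))
    arith = solve-∀

  module _ (p q : Fin n → Bool) (compl : ∀ v → q v ≡ not (p v)) (W : List (Fin n)) (large : suc (length W) < # p) where

    cross-one : ∀ {x} → p x ≡ true → 2 * # p ≤ n → 0 < crossDegree q x
    cross-one {x} px le = *-cancelˡ-< 2 0 (crossDegree q x) (linear 1 (+-mono-≤ (crossing-degree p q compl px) le)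
      (arith n (# p) (crossDegree q x)))
      where
      arith : ∀ n p d → 1 + (2 * p + 2 * d + n) + 1 ≡ 2 * d + (n + 2 + 2 * p)
      arith = solve-∀

    cross-two : ∀ {x} → p x ≡ true → 2 * # p < n → 1 < crossDegree q x
    cross-two {x} px lt = *-cancelˡ-< 2 1 (crossDegree q x) (linear 0 (+-mono-≤ (crossing-degree p q compl px) lt)
      (arith n (# p) (crossDegree q x)))
      where
      arith : ∀ n p d → suc (2 * 1) + (2 * p + 2 * d + n) + 0 ≡ 2 * d + (n + 2 + suc (2 * p))
      arith = solve-∀

    neighbour : ∀ x → 0 < crossDegree q x → ∃[ y ] (q y ≡ true × adj G x y ≡ true)
    neighbour x pos with pick (λ v → q v ∧ adj G x v) [] pos
    ... | y , e , _ = y , proj₁ (∧-true e) , proj₂ (∧-true {q y} e)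

    -- The edge `x′ z` can meet only one of the edges `x y` and `x y′`; the other one is taken with
    -- it. Both edges are spare by their ends in `p`.
    fan : ∀ {x x′ y y′ z} → p x ≡ true → p x′ ≡ true → member W x ≡ false → member W x′ ≡ false → x ≢ x′ →
          q y ≡ true → q y′ ≡ true → y ≢ y′ → adj G x y ≡ true → adj G x y′ ≡ true →
          q z ≡ true → adj G x′ z ≡ true → SpareEdges G p q W
    fan {x} {x′} {y} {y′} {z} px px′ wx wx′ x≢x′ qy qy′ y≢y′ xy xy′ qz x′z with y ≟ z
    ... | no y≢z = record
      { px₁ = px ; px₂ = px′ ; qy₁ = qy ; qy₂ = qz ; x₁≢x₂ = x≢x′ ; y₁≢y₂ = y≢z
      ; edge₁ = xy ; edge₂ = x′z ; spare₁ = inj₁ wx ; spare₂ = inj₁ wx′ }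
    ... | yes refl = record
      { px₁ = px ; px₂ = px′ ; qy₁ = qy′ ; qy₂ = qz ; x₁≢x₂ = x≢x′ ; y₁≢y₂ = y≢y′ ∘ sym
      ; edge₁ = xy′ ; edge₂ = x′z ; spare₁ = inj₁ wx ; spare₂ = inj₁ wx′ }

    spare-edges-unbalanced : 2 * # p < n → SpareEdges G p q W
    spare-edges-unbalanced lt =
      let (x , px , wx)    = pick p W (<⇒≤ large)
          (x′ , px′ , wx′) = pick p (x ∷ W) large
          (x≢x′ , wx′)     = member-∷ {xs = W} wx′
          (y , qy , xy)    = neighbour x (<⇒≤ (cross-two px lt))
          (y′ , e , ny)    = pick (λ v → q v ∧ adj G x v) (y ∷ []) (cross-two px lt)
          (z , qz , x′z)   = neighbour x′ (<⇒≤ (cross-two px′ lt))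
      in fan px px′ wx wx′ x≢x′ qy (proj₁ (∧-true e)) (proj₁ (member-∷ {xs = []} ny)) xy (proj₂ (∧-true {q y′} e)) qz x′z

    -- Only one crossing neighbour per vertex is guaranteed here. The edges `x y` and `t y′`, with
    -- `x` and `y′` outside `W`, are disjoint unless `t` is `x`; in that case `x` has two neighbours
    -- across and `fan` applies.
    spare-edges-balanced : 2 * # p ≤ n → 2 * # q ≤ n → suc (length W) < # q → SpareEdges G p q W
    spare-edges-balanced ple qle large′ =
      let (x , px , wx)    = pick p W (<⇒≤ large)
          (x′ , px′ , wx′) = pick p (x ∷ W) large
          (x≢x′ , wx′)     = member-∷ {xs = W} wx′
          (y , qy , xy)    = neighbour x (cross-one px ple)
          (z , qz , x′z)   = neighbour x′ (cross-one px′ ple)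
          (y′ , qy′ , wy′) = pick q (y ∷ W) large′
          (y≢y′ , wy′)     = member-∷ {xs = W} wy′
          (t , e , _)      = pick (λ v → p v ∧ adj G y′ v) [] (back qy′)
          ty′              = trans (Graph.sym G t y′) (proj₂ (∧-true {p t} e))
      in finish (x ≟ t) px px′ wx wx′ x≢x′ qy xy qz x′z qy′ wy′ y≢y′ (proj₁ (∧-true e)) ty′
      where
      back : ∀ {y} → q y ≡ true → 0 < crossDegree p y
      back {y} qy = *-cancelˡ-< 2 0 (crossDegree p y)
        (linear 1 (+-mono-≤ (crossing-degree q p (λ v → trans (double (p v)) (cong not (sym (compl v)))) qy) qle)
                  (arith n (# q) (crossDegree p y)))
        where
        double : ∀ a → a ≡ not (not a)
        double true  = refl
        double false = refl
        arith : ∀ n p d → 1 + (2 * p + 2 * d + n) + 1 ≡ 2 * d + (n + 2 + 2 * p)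
        arith = solve-∀
      finish : ∀ {x x′ y y′ z t} → Dec (x ≡ t) → p x ≡ true → p x′ ≡ true → member W x ≡ false →
               member W x′ ≡ false → x ≢ x′ → q y ≡ true → adj G x y ≡ true → q z ≡ true → adj G x′ z ≡ true →
               q y′ ≡ true → member W y′ ≡ false → y ≢ y′ → p t ≡ true → adj G t y′ ≡ true → SpareEdges G p q W
      finish (yes refl) px px′ wx wx′ x≢x′ qy xy qz x′z qy′ wy′ y≢y′ pt ty′ =
        fan px px′ wx wx′ x≢x′ qy qy′ y≢y′ xy ty′ qz x′z
      finish (no x≢t) px px′ wx wx′ x≢x′ qy xy qz x′z qy′ wy′ y≢y′ pt ty′ = record
        { px₁ = px ; px₂ = pt ; qy₁ = qy ; qy₂ = qy′ ; x₁≢x₂ = x≢t ; y₁≢y₂ = y≢y′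
        ; edge₁ = xy ; edge₂ = ty′ ; spare₁ = inj₁ wx ; spare₂ = inj₂ wy′ }

  spare-edges : ∀ p q → (∀ v → q v ≡ not (p v)) → ∀ W → suc (length W) < # p → suc (length W) < # q →
                SpareEdges G p q W
  spare-edges p q compl W large large′ with 2 * # p <? n | 2 * # q <? n
  ... | yes lt | _      = spare-edges-unbalanced p q compl W large lt
  ... | no _   | yes lt = swap-spare (spare-edges-unbalanced q p compl′ W large′ lt)
    where
    compl′ : ∀ v → p v ≡ not (q v)
    compl′ v rewrite compl v with p v
    ... | true  = refl
    ... | false = refl
  ... | no ≮p  | no ≮q  = spare-edges-balanced p q compl W large (bound (# p) (# q) halves ≮q) (bound (# q) (# p) (trans (+-comm (# q) (# p)) halves) ≮p) large′
    where
    pointwise : ∀ v → bit (p v) + bit (q v) ≡ 1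
    pointwise v rewrite compl v with p v
    ... | true  = refl
    ... | false = refl
    halves : # p + # q ≡ n
    halves = trans (sym (∑-+ (bit ∘ p) (bit ∘ q) (allFin n))) (trans (∑-cong pointwise (allFin n)) (#-full n))
    bound : ∀ a b → a + b ≡ n → ¬ 2 * b < n → 2 * a ≤ n
    bound a b e ≮ = linear 0 (+-mono-≤ (≮⇒≥ ≮) (*-monoʳ-≤ 2 (≤-reflexive e))) (arith n a b)
      where
      arith : ∀ n a b → 2 * a + (2 * b + 2 * n) + 0 ≡ n + (n + 2 * (a + b))
      arith = solve-∀

  -- A cover by fewer than `k` vertices would separate `p` from `q` in `G`: each side has at least
  -- `k` vertices, hence one outside the cover.
  crossing-matching : ∀ {k} p q → (∀ v → q v ≡ not (p v)) → KConnected (adj G) k → k ≤ # p → k ≤ # q →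
    Σ (List (Fin n × Fin n)) λ E → (∀ {u v} → (u , v) ∈ₗ E → p u ≡ true × q v ≡ true × adj G u v ≡ true) × Matching E k
  crossing-matching {k} p q compl connected kp kq = E , crosses , [ id , ⊥-elim ∘ separation-refutes connected ∘ separation ]′ (könig E k)
    where
    crossing? : ∀ e → Dec (p (proj₁ e) ≡ true × q (proj₂ e) ≡ true × adj G (proj₁ e) (proj₂ e) ≡ true)
    crossing? (u , v) = (p u ≟ᵇ true) ×-dec (q v ≟ᵇ true) ×-dec (adj G u v ≟ᵇ true)
    pairs = cartesianProduct (allFin n) (allFin n)
    E = filter crossing? pairs
    crosses : ∀ {u v} → (u , v) ∈ₗ E → p u ≡ true × q v ≡ true × adj G u v ≡ true
    crosses e∈ = proj₂ (∈-filter⁻ crossing? {xs = pairs} e∈)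
    separation : Cover E k → Separation (adj G) k
    separation (cover P Q small covers) =
      let (u , pu , su) = pick p (P ++ Q) (<-≤-trans size kp)
          (v , qv , sv) = pick q (P ++ Q) (<-≤-trans size kq)
      in record
        { separator = member (P ++ Q) ; side = p ; small = ≤-<-trans (#-member (P ++ Q)) size
        ; closed = closed ; inner = u ; outer = v ; inner-free = su ; outer-free = sv ; inner-side = pu
        ; outer-side = not-true (trans (sym (compl v)) qv) }
      where
      size : length (P ++ Q) < k
      size = subst (_< k) (sym (length-++ P)) small
      closed : Closed (adj G) (member (P ++ Q)) p
      closed u v su sv e pu with p v in pv
      ... | true  = refl
      ... | false with covers (∈-filter⁺ crossing? (∈-cartesianProduct⁺ (∈-allFin u) (∈-allFin v))
                                 (pu , trans (compl v) (cong not pv) , e))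
      ...   | inj₁ u∈ = true≢false (∈⇒member (∈-++⁺ˡ u∈)) su
      ...   | inj₂ v∈ = true≢false (∈⇒member (∈-++⁺ʳ P v∈)) sv

-- Crossing between the clusters along two given edges

filterᵇ-partition : ∀ {A : Set} (p q : A → Bool) → (∀ v → q v ≡ not (p v)) → ∀ xs → filterᵇ p xs ++ filterᵇ q xs ↭ xs
filterᵇ-partition p q compl []       = ↭-refl
filterᵇ-partition p q compl (x ∷ xs) rewrite compl x with p x
... | true  = prep x (filterᵇ-partition p q compl xs)
... | false = ↭-trans (Perm.shift x (filterᵇ p xs) (filterᵇ q xs)) (prep x (filterᵇ-partition p q compl xs))

Path-map-All : ∀ {V : Set} {R S : V → V → Set} {P : V → Set} → (∀ {u v} → R u v → P u → P v → S u v) →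
               ∀ u xs → Path R u xs → All.All P (u ∷ xs) → Path S u xs
Path-map-All f u []       _       _                 = tt
Path-map-All f u (x ∷ xs) (r , p) (pu ∷ᵃ px ∷ᵃ pxs) = f r pu px , Path-map-All f x xs p (px ∷ᵃ pxs)

all-verticesOf : ∀ {n} {p : Fin n → Bool} {xs} → xs ↭ verticesOf p → All.All (λ v → p v ≡ true) xs
all-verticesOf {n} {p} r = Perm.All-resp-↭ (↭-sym r) (All.tabulate λ {v} v∈ →
  Equivalence.to T-≡ (proj₂ (∈-filter⁻ (T? ∘ p) {xs = allFin n} v∈)))

unique⇒distinct : ∀ {n} {xs : List (Fin n)} → Unique xs → Distinct xs
unique⇒distinct                 []ᵖ       v = z≤n
unique⇒distinct {xs = x ∷ xs} (x∉ ∷ᵖ u) v with x == v in e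
... | false = unique⇒distinct u v
... | true  = s≤s (≤-reflexive (absent xs x∉))
  where
  absent : ∀ xs → All.All (x ≢_) xs → count (_== v) xs ≡ 0
  absent []       _           = refl
  absent (y ∷ ys) (x≢y ∷ᵃ a) with y == v in e′
  ... | true  = ⊥-elim (x≢y (trans (==-sound {u = x} e) (sym (==-sound e′))))
  ... | false = absent ys a

-- If every edge of `M` had an end in `s`, the two lists of ends would contribute at least
-- `length M`.
free-edge : ∀ {n} (s : Fin n → Bool) (M : List (Fin n × Fin n)) →
  count s (map proj₁ M ++ map proj₂ M) < length M →
  ∃[ u ] ∃[ v ] ((u , v) ∈ₗ M × s u ≡ false × s v ≡ false)
free-edge s M lt = go M (subst (_< length M) (∑-++ (bit ∘ s) (map proj₁ M) (map proj₂ M)) lt)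
  where
  go : ∀ M → count s (map proj₁ M) + count s (map proj₂ M) < length M →
       ∃[ u ] ∃[ v ] ((u , v) ∈ₗ M × s u ≡ false × s v ≡ false)
  go ((u , v) ∷ M) lt with s u in su | s v in sv
  ... | false | false = u , v , here refl , su , sv
  ... | true  | false = let (a , b , e , r) = go M (≤-pred lt) in a , b , there e , r
  ... | false | true  =
    let (a , b , e , r) = go M (≤-pred (subst (_< suc (length M)) (+-suc _ _) lt)) in a , b , there e , r
  ... | true  | true  =
    let (a , b , e , r) = go M (≤-trans (s≤s (+-monoʳ-≤ _ (n≤1+n _))) (≤-pred lt)) in a , b , there e , r

module _ {n k : ℕ} (G : Graph n) (half : ∀ u → n ≤ 2 * # (adj G u)) (connected : KConnected (adj G) k)
         (large : 6 * k + 10 ≤ n) (pair : ClusterPair G k) where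

  open ClusterPair pair
  private
    p q : Fin n → Bool
    p = Cluster.hull X
    q = Cluster.hull Y

    module _ {W : List (Fin n)} (E : SpareEdges G p q W) where
      open SpareEdges E

      -- The crossing steps appear in the direction of traversal: out of `X` along `x₂ y₂`, back
      -- along `y₁ x₁`.
      Allowed : Fin n → Fin n → Set
      Allowed u v = adj G u v ≡ true × (p u ≡ p v ⊎ (u ≡ x₂ × v ≡ y₂) ⊎ (u ≡ y₁ × v ≡ x₁))

      cross-cycle : HamiltonianCycleIn G Allowed
      cross-cycle with hull-path X large px₁ px₂ x₁≢x₂ | hull-path Y large qy₂ qy₁ (y₁≢y₂ ∘ sym)
      ... | xs , xs↭ , xs-end , xs-path | ys , ys↭ , ys-end , ys-path =
        fromClosedPath G Allowed proj₁ n≥3 x₁ (xs ++ y₂ ∷ ys ++ x₁ ∷ []) path closed spanning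
        where
        n≥3 : 3 ≤ n
        n≥3 = ≤-trans (m≤n+m 3 (6 * k + 7)) (≤-trans (≤-reflexive (+-assoc (6 * k) 7 3)) large)
        within-X : Path Allowed x₁ xs
        within-X = Path-map-All (λ e pu pv → e , inj₁ (trans pu (sym pv))) x₁ xs xs-path (all-verticesOf xs↭)
        p-false : ∀ {v} → q v ≡ true → p v ≡ false
        p-false {v} qv = not-true (trans (sym (complementary v)) qv)
        within-Y : Path Allowed y₂ ys
        within-Y = Path-map-All (λ e qu qv → e , inj₁ (trans (p-false qu) (sym (p-false qv)))) y₂ ys ys-path (all-verticesOf ys↭)
        path : Path Allowed x₁ (xs ++ y₂ ∷ ys ++ x₁ ∷ [])
        path = Path-++ x₁ xs _ within-X
          (subst (λ z → Path Allowed z (y₂ ∷ ys ++ x₁ ∷ [])) (sym xs-end)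
            ((edge₂ , inj₂ (inj₁ (refl , refl))) , Path-++ y₂ ys _ within-Y
              (subst (λ z → Path Allowed z (x₁ ∷ [])) (sym ys-end)
                ((trans (Graph.sym G _ _) edge₁ , inj₂ (inj₂ (refl , refl))) , tt))))
        closed : end x₁ (xs ++ y₂ ∷ ys ++ x₁ ∷ []) ≡ x₁
        closed = trans (end-++ x₁ xs _) (end-++ y₂ ys (x₁ ∷ []))
        spanning : xs ++ y₂ ∷ ys ++ x₁ ∷ [] ↭ allFin n
        spanning = ↭-trans (↭-reflexive (sym (++-assoc xs (y₂ ∷ ys) (x₁ ∷ []))))
          (↭-trans (Perm.++-comm (xs ++ y₂ ∷ ys) (x₁ ∷ []))
          (↭-trans (Perm.++⁺ xs↭ ys↭) (filterᵇ-partition p q complementary (allFin n))))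

    core≤hull : (C : Cluster G k) → # (Cluster.core C) ≤ # (Cluster.hull C)
    core≤hull C = #-mono {p = Cluster.core C} (λ v → Cluster.core⊆hull C {v})

    -- Two vertices of each hull are needed beyond the `k + k` ends of the matching.
    hull-large : (C : Cluster G k) → suc (k + k) < # (Cluster.hull C)
    hull-large C = <-≤-trans (halve {suc (k + k)} (linear 7 (+-mono-≤ (Cluster.core-lower C) large)
      (arith n k (# (Cluster.core C))))) (core≤hull C)
      where
      arith : ∀ n k c → suc (2 * suc (k + k)) + (2 * c + 2 * k + n) + 7 ≡ 2 * c + (n + (6 * k + 10))
      arith = solve-∀

    k≤hull : (C : Cluster G k) → k ≤ # (Cluster.hull C)
    k≤hull C = ≤-trans (<⇒≤ (core-large C large)) (core≤hull C)

    module _ {crossing : List (Fin n × Fin n)}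
             (crosses : ∀ {u v} → (u , v) ∈ₗ crossing → p u ≡ true × q v ≡ true × adj G u v ≡ true)
             (M : Matching crossing k) where
      open Matching M
      W : List (Fin n)
      W = map proj₁ edges ++ map proj₂ edges
      W-length : length W ≡ k + k
      W-length = trans (length-++ (map proj₁ edges))
        (cong₂ _+_ (trans (length-map proj₁ edges) size) (trans (length-map proj₂ edges) size))
      spare : SpareEdges G p q W
      spare = spare-edges G half p q complementary W
        (subst (λ l → suc l < # p) (sym W-length) (hull-large X))
        (subst (λ l → suc l < # q) (sym W-length) (hull-large Y))

      disjoint : Disjoint (map proj₁ edges) (map proj₂ edges)
      disjoint (a , b) with ∈-map⁻ proj₁ a | ∈-map⁻ proj₂ b
      ... | e , e∈ , refl | e′ , e′∈ , eq = true≢false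
        (subst (λ v → q v ≡ true) (sym eq) (proj₁ (proj₂ (crosses (included e′∈)))))
        (trans (complementary (proj₁ e)) (cong not (proj₁ (crosses (included e∈)))))
      W-distinct : Distinct W
      W-distinct = unique⇒distinct (Unique.++⁺ left-unique right-unique disjoint)

      module _ (E : SpareEdges G p q W) (H : HamiltonianCycle G)
               (allowed : ∀ i → Allowed E (order H i) (order H (next i))) where
        open SpareEdges E

        not-spare : ∀ {x y} → member W x ≡ true → member W y ≡ true → ¬ (member W x ≡ false ⊎ member W y ≡ false)
        not-spare wx wy = [ true≢false wx , true≢false wy ]′

        not-in-cycle : ∀ {u v} → (u , v) ∈ₗ edges → ¬ Allowed E u v × ¬ Allowed E v u
        not-in-cycle {u} {v} uv∈ =
          (λ { (_ , inj₁ same)                → true≢false pu (trans same pv)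
             ; (_ , inj₂ (inj₁ (refl , refl))) → not-spare wu wv spare₂
             ; (_ , inj₂ (inj₂ (refl , refl))) → not-spare wv wu spare₁ }) ,
          (λ { (_ , inj₁ same)                → true≢false pu (trans (sym same) pv)
             ; (_ , inj₂ (inj₁ (refl , refl))) → not-spare wv wu spare₂
             ; (_ , inj₂ (inj₂ (refl , refl))) → not-spare wu wv spare₁ })
          where
          wu = ∈⇒member {xs = W} (∈-++⁺ˡ (∈-map⁺ proj₁ uv∈))
          wv = ∈⇒member {xs = W} (∈-++⁺ʳ (map proj₁ edges) (∈-map⁺ proj₂ uv∈))
          pu = proj₁ (crosses (included uv∈))
          pv = not-true (trans (sym (complementary v)) (proj₁ (proj₂ (crosses (included uv∈)))))

        kept : ∀ {u v} → (u , v) ∈ₗ edges → minusCycle G H u v ≡ true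
        kept {u} {v} uv∈ with cycleEdge H u v in e
        ... | false = true-∧ (proj₂ (proj₂ (crosses (included uv∈)))) refl
        ... | true with cycleEdge-witness H e
        ...   | i , inj₁ (refl , refl) = ⊥-elim (proj₁ (not-in-cycle uv∈) (allowed i))
        ...   | i , inj₂ (refl , refl) = ⊥-elim (proj₂ (not-in-cycle uv∈) (allowed i))

        -- The ends of the matching are distinct, so some edge `u v` of it avoids the separator, and
        -- it is not on the cycle. It joins the side of the hull of `X` to that of `Y`, which leaves
        -- no second side.
        refute : Separation (minusCycle G H) k → ⊥
        refute sep = conclude (free-edge s edges
            (subst (count s W <_) (sym size) (≤-<-trans (count-distinct s W W-distinct) small)))
          where
          open Separation sep renaming (separator to s)
          b-sym = minusCycle-sym G H
          b-irrefl = minusCycle-irrefl G H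
          conclude : ∃[ u ] ∃[ v ] ((u , v) ∈ₗ edges × s u ≡ false × s v ≡ false) → ⊥
          conclude (u , v , uv∈ , su , sv) = true≢false inner-side
            (trans (all-one-side inner inner-free) (trans (sym (all-one-side outer outer-free)) outer-side))
            where
            across : side v ≡ side u
            across = same-side X large b-sym b-irrefl (degree-loss H) small closed su sv (kept uv∈)
            all-one-side : ∀ z → s z ≡ false → side z ≡ side u
            all-one-side z sz with p z in pz
            ... | true  = hull-one-sided X large b-sym b-irrefl (degree-loss H) small closed
                            pz (proj₁ (crosses (included uv∈))) sz su
            ... | false = trans (hull-one-sided Y large b-sym b-irrefl (degree-loss H) small closed
                            (trans (complementary z) (cong not pz)) (proj₁ (proj₂ (crosses (included uv∈)))) sz sv) across

      cross-connected-by : Σ (HamiltonianCycle G) λ H → KConnected (minusCycle G H) k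
      cross-connected-by =
        let (H , allowed) = cross-cycle spare
        in H , [ id , ⊥-elim ∘ refute spare H allowed ]′ (connected-or-separation (minusCycle G H) (proj₁ connected))

  cross-connected : Σ (HamiltonianCycle G) λ H → KConnected (minusCycle G H) k
  cross-connected =
    let (_ , crosses , M) = crossing-matching G half p q complementary connected (k≤hull X) (k≤hull Y)
    in cross-connected-by crosses M

-- The bound on the order and the conclusion

ceilDiv≤1 : ∀ k → 2 ≤ k → ceilDiv (k ∸ 2) k ≤ 1
ceilDiv≤1 (suc zero) (s≤s ())
ceilDiv≤1 (suc (suc j)) _ = ≤-pred (m<n*o⇒m/o<n {j + suc j} {2} {2 + j}
  (≤-trans (s≤s (+-mono-≤ (n≤1+n j) (n≤1+n (suc j)))) (≤-reflexive (arith j))))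
  where
  arith : ∀ j → suc (suc j + suc (suc j)) ≡ 2 * (2 + j)
  arith = solve-∀

theorem4 : (k : ℕ) → 2 ≤ k → (n : ℕ) → (G : Graph n) → KConnected (adj G) k
    → 6 * k + 12 ∸ 2 * ceilDiv (k ∸ 2) k ≤ n
    → minDegreeAtLeastHalf G
    → Σ (HamiltonianCycle G) (λ H → KConnected (minusCycle G H) k)
theorem4 k k≥2 n G connected order≥ δ =
  [ (λ c → H , c) , (λ sep → cross-connected G half connected large (separation-clusters G half H sep)) ]′
    (connected-or-separation (minusCycle G H) (proj₁ connected))
  where
  half : ∀ u → n ≤ 2 * # (adj G u)
  half = halfDegree G δ
  -- The ceiling is 0 for `k = 2` and 1 for larger `k`, so the order is at least `6 * k + 10` in
  -- both cases.
  large : 6 * k + 10 ≤ n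
  large = ≤-trans (≤-trans (≤-reflexive (sym (+-∸-assoc (6 * k) {12} {2} (s≤s (s≤s z≤n)))))
    (∸-monoʳ-≤ (6 * k + 12) (*-monoʳ-≤ 2 (ceilDiv≤1 k k≥2)))) order≥
  H : HamiltonianCycle G
  H = dirac G (≤-trans (s≤s k≥2) (proj₁ connected)) δ
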